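{- There exists a randomized algorithm which, given cut-query oracle access to an unweighted, undirected, simple graph $G=(V,E)$ on $n$ vertices, computes an exact global minimum cut of $G$ with high probability using $\widetilde{O}(n)$ oracle queries.
   Context: Cut-query oracle: on query $S\subseteq V$, the oracle returns $c(S)$, the number of edges of $G$ with exactly one endpoint in $S$. A global minimum cut is a set $\emptyset\neq S\subsetneq V$ minimizing $c(S)$. "With high probability" means with probability at least $1-n^{ -\Omega(1)}$. $\widetilde{O}(x)$ denotes $O(x\cdot\mathrm{polylog}(x))$. -}

module Defs where

open import Data.Bool using (Bool; true; false; _∧_; _∨_; not; if_then_else_)
open import Data.Nat using (ℕ; zero; suc; _+_; _*_; _≤ᵇ_; _⊔_)
open import Data.Fin using (Fin; _<_)
open import Data.Fin.Subset using (Subset)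
open import Data.Vec using (Vec; []; _∷_; lookup)
open import Data.List using (List; []; _∷_; map; _++_; length; filter)
open import Data.List.Base using (allFin; cartesianProduct)
open import Data.Product using (_,_; _×_)
open import Relation.Binary.PropositionalEquality using (_≡_)
open import Relation.Nullary using (¬_)
import Data.Rational
open import Data.Rational using (ℚ; 0ℚ; 1ℚ; ½) renaming (_+_ to _+q_; _*_ to _*q_)

record Graph (n : ℕ) : Set where
  field
    adj   : Fin n → Fin n → Bool
    sym   : ∀ u v → adj u v ≡ adj v u
    irrefl : ∀ v → adj v v ≡ false
open Graph public

xor : Bool → Bool → Bool
xor a b = (a ∧ not b) ∨ (not a ∧ b)

isLt : ∀ {n} → Fin n → Fin n → Bool
isLt u v with u Data.Fin.<? v
... | Relation.Nullary.yes _ = true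
... | Relation.Nullary.no _ = false
  where open import Data.Fin using (_<?_)

pairs : ℕ → Set
pairs n = Fin n × Fin n

cut : ∀ {n} → Graph n → Subset n → ℕ
cut {n} G S = length (filter crosses? (cartesianProduct (allFin n) (allFin n)))
  where
    open import Relation.Nullary.Decidable using (Dec)
    open import Data.Bool using (T; T?)
    crossesB : Fin n × Fin n → Bool
    crossesB (u , v) = isLt u v ∧ adj G u v ∧ xor (lookup S u) (lookup S v)
    crosses? : (p : Fin n × Fin n) → Dec (T (crossesB p))
    crosses? p = T? (crossesB p)

allSubsets : (n : ℕ) → List (Subset n)
allSubsets zero = [] ∷ []
allSubsets (suc n) = map (true ∷_) (allSubsets n) ++ map (false ∷_) (allSubsets n)

nontrivialᵇ : ∀ {n} → Subset n → Bool
nontrivialᵇ S = anyV S ∧ anyV (notV S)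
  where
    anyV : ∀ {m} → Vec Bool m → Bool
    anyV [] = false
    anyV (b ∷ bs) = b ∨ anyV bs
    notV : ∀ {m} → Vec Bool m → Vec Bool m
    notV [] = []
    notV (b ∷ bs) = not b ∷ notV bs

allL : ∀ {A : Set} → (A → Bool) → List A → Bool
allL p [] = true
allL p (x ∷ xs) = p x ∧ allL p xs

isMinCutᵇ : ∀ {n} → Graph n → Subset n → Bool
isMinCutᵇ {n} G S =
  nontrivialᵇ S ∧ allL (λ T → not (nontrivialᵇ T) ∨ (cut G S ≤ᵇ cut G T)) (allSubsets n)

-- Randomized cut-query algorithms on n vertices, as (well-founded)
-- decision trees: query the oracle on a set S and continue depending on
-- the answer c(S); flip a fair coin; or output a set.

data Alg (n : ℕ) : Set where
  query  : Subset n → (ℕ → Alg n) → Alg n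
  coin   : (Bool → Alg n) → Alg n
  output : Subset n → Alg n

queries : ∀ {n} → Graph n → Alg n → ℕ
queries G (query S k) = suc (queries G (k (cut G S)))
queries G (coin f)    = queries G (f true) ⊔ queries G (f false)
queries G (output _)  = 0

failProb : ∀ {n} → Graph n → Alg n → ℚ
failProb G (query S k) = failProb G (k (cut G S))
failProb G (coin f)    = ½ *q (failProb G (f true) +q failProb G (f false))
failProb G (output S)  = if isMinCutᵇ G S then 0ℚ else 1ℚ

_^q_ : ℚ → ℕ → ℚ
q ^q zero = 1ℚ
q ^q suc k = q *q (q ^q k)

ℕ→ℚ : ℕ → ℚ
ℕ→ℚ n = (Data.Integer.+ n) Data.Rational./ 1
  where import Data.Integer

{-# OPTIONS --safe #-}
-- Let δ be the minimum degree and let X be a minimum cut with λ < δ edges (if λ = δ, a singleton is minimum).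
-- Contract repeatedly: take a smallest class S, of size s with 2 s ≤ δ, and merge it with the class across a random
-- outgoing edge.  As G is simple, S has at least s δ / 2 outgoing edges, so the edge lies in X with probability at
-- most 2 c(S) / (s δ), where c(S) counts the edges of X at S; as classes at least double when they are picked, these
-- risks sum to O(λ / δ) = O(1).  Each single risk is at most about 1 / 2, because moving S across X cannot decrease
-- the cut.  So X survives with constant probability, and at most 2 n / δ classes remain.
--
-- A minimum cut that respects these classes is then found by learning edges: take a lightest cut of the known edges
-- between classes; if its true value agrees, it is minimum, and otherwise it yields an unknown edge.  Edges are only
-- added across cuts with fewer than δ known edges, so w classes never span more than δ (w − 1) known edges, and the
-- process ends after O(n) edges.  A random or unknown edge costs O(log n) queries by binary search.  O(log n)
-- independent trials leave a failure probability of at most 1 / n.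
module Submission where

open import Defs hiding (sym)
open import Data.Bool using (Bool; true; false; _∧_; _∨_; not; if_then_else_; T) renaming (_xor_ to _⊻_)
import Data.Bool.Properties as Bool
open import Data.Empty using (⊥; ⊥-elim)
open import Data.Fin as Fin using (Fin; zero; suc; toℕ; fromℕ<)
import Data.Fin.Properties as Fin
open import Data.Fin.Subset using (Subset)
import Data.Integer as ℤ
import Data.Integer.Properties as ℤ
open import Data.List as List using (List; []; _∷_; _++_; length; map; filter; cartesianProduct)
open import Data.List.Membership.Propositional using (_∈_)
open import Data.List.Membership.Propositional.Properties using (∈-++⁺ˡ; ∈-++⁺ʳ; ∈-map⁺; ∈-allFin)
open import Data.List.Properties using (filter-++; length-++; length-tabulate)
open import Data.List.Relation.Unary.Any using (here; there)
open import Data.Maybe using (Maybe; just; nothing)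
open import Data.Maybe.Properties using (just-injective)
open import Data.Nat
open import Data.Nat.DivMod
open import Data.Nat.Induction using (<-rec)
open import Data.Nat.Logarithm
open import Data.Nat.Properties
open import Data.Nat.Tactic.RingSolver using (solve-∀)
open import Data.Product using (Σ; ∃; _×_; _,_; proj₁; proj₂)
open import Data.Rational using (ℚ; 0ℚ; 1ℚ; ½; toℚᵘ; fromℚᵘ; NonNegative; Positive) renaming (_+_ to _+q_; _*_ to _*q_; _≤_ to _≤q_)
import Data.Rational as ℚ
import Data.Rational.Properties as ℚ
import Data.Rational.Solver
open import Data.Rational.Unnormalised using (mkℚᵘ; *≡*; *≤*)
import Data.Rational.Unnormalised as ℚᵘ
import Data.Rational.Unnormalised.Properties as ℚᵘ
open import Data.Vec using (Vec; []; _∷_; lookup; tabulate)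
open import Data.Vec.Properties using (lookup∘tabulate)
open import Function using (_∘_; id)
open import Relation.Binary.Definitions using (tri<; tri≈; tri>)
open import Relation.Binary.PropositionalEquality
open import Relation.Nullary using (¬_; Dec; yes; no; does; contradiction)
open import Relation.Unary using (Decidable)
open import Algebra.Properties.Semiring.Sum +-*-semiring using (sum; sum-cong-≗; ∑-distrib-+; ∑-comm; *-distribˡ-sum; *-distribʳ-sum; sum-replicate-zero)

-- The sizes of the classes and the risks of later steps depend on earlier draws, so the risks
-- cannot simply be added in advance. The proof therefore carries a number `B` and claims success
-- with probability at least `(B / scale) ^ suc k` as long as `B + potential ≤ scale`. The potential
-- charges every end `u` of an edge of `X` about `2 ^ n / s`, where `s` is the size of the class of
-- `u`. When that class is picked and merged, the charge at least halves, and one half of it moves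
-- into `B`. By Bernoulli's inequality the growth of `B ^ suc k` outweighs the chance of a bad draw
-- once `54 ≤ suc k`. Failure is measured relative to what follows: if the continuation fails with
-- probability at most `y`, a routine with success `s / D` fails with probability at most
-- `(1 - s / D) * y`. Such bounds compose along the decision tree, and with the denominators cleared
-- they reduce to counting in the natural numbers. Only queries are charged in this model, so
-- lightest cuts may be found by exhaustive search over all subsets.

private variable
  n N : ℕ

-- Sums and bilinear forms

sum-mono : {f g : Fin n → ℕ} → (∀ i → f i ≤ g i) → sum f ≤ sum g
sum-mono {zero}  p = z≤n
sum-mono {suc n} p = +-mono-≤ (p zero) (sum-mono (p ∘ suc))

sum-zero : {f : Fin n → ℕ} → (∀ i → f i ≡ 0) → sum f ≡ 0
sum-zero {n} p = trans (sum-cong-≗ p) (sum-replicate-zero n)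

term≤sum : (f : Fin n → ℕ) (i : Fin n) → f i ≤ sum f
term≤sum f zero    = m≤m+n _ _
term≤sum f (suc i) = ≤-trans (term≤sum (f ∘ suc) i) (m≤n+m _ _)

sum-const : ∀ n c → sum {n} (λ _ → c) ≡ n * c
sum-const zero    c = refl
sum-const (suc n) c = cong (c +_) (sum-const n c)

0<m*n⇒0<m : ∀ {m n} → 0 < m * n → 0 < m
0<m*n⇒0<m {suc m} _ = s≤s z≤n

0<m*n⇒0<n : ∀ m {n} → 0 < m * n → 0 < n
0<m*n⇒0<n m {suc n} _ = s≤s z≤n
0<m*n⇒0<n m {zero}  p = subst (0 <_) (*-zeroʳ m) p

T⇒true : ∀ {b} → T b → b ≡ true
T⇒true {true} _ = refl

not-true⇒false : ∀ {b} → not b ≡ true → b ≡ false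
not-true⇒false {false} _ = refl

⟦_⟧ : Bool → ℕ
⟦ true ⟧  = 1
⟦ false ⟧ = 0

⟦⟧≤1 : ∀ b → ⟦ b ⟧ ≤ 1
⟦⟧≤1 true  = ≤-refl
⟦⟧≤1 false = z≤n

infixr 7 _==_
_==_ : Fin n → Fin n → Bool
u == v = does (u Fin.≟ v)

==-refl : (u : Fin n) → (u == u) ≡ true
==-refl u with u Fin.≟ u
... | yes _ = refl
... | no ¬p = contradiction refl ¬p

==⇒≡ : {u v : Fin n} → (u == v) ≡ true → u ≡ v
==⇒≡ {u = u} {v} e with u Fin.≟ v
... | yes p = p

sum-δ : (u : Fin n) (f : Fin n → ℕ) → sum (λ v → ⟦ u == v ⟧ * f v) ≡ f u
sum-δ zero f = trans (cong₂ _+_ (+-identityʳ (f zero)) (sum-zero {f = λ v → ⟦ zero == suc v ⟧ * f (suc v)} λ _ → refl)) (+-identityʳ (f zero))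
sum-δ (suc u) f = trans (sum-cong-≗ λ v → cong (λ b → ⟦ b ⟧ * f (suc v)) (suc-== u v)) (sum-δ u (f ∘ suc))
  where
  suc-== : ∀ {n} (u v : Fin n) → (suc u == suc v) ≡ (u == v)
  suc-== u v with u Fin.≟ v
  ... | yes _ = refl
  ... | no _  = refl

Matrix : ℕ → Set
Matrix n = Fin n → Fin n → ℕ

Symmetric : Matrix n → Set
Symmetric M = ∀ u v → M u v ≡ M v u

module _ where

  private variable
    M M′ : Matrix n
    f f′ g g′ h : Fin n → ℕ

  abstract
    form : Matrix n → (Fin n → ℕ) → (Fin n → ℕ) → ℕ
    form M f g = sum λ u → sum λ v → f u * (M u v * g v)

    form-def : form M f g ≡ sum λ u → sum λ v → f u * (M u v * g v)
    form-def = refl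

    form-cong : (∀ u v → M u v ≡ M′ u v) →
                (∀ u → f u ≡ f′ u) → (∀ u → g u ≡ g′ u) → form M f g ≡ form M′ f′ g′
    form-cong p q r = sum-cong-≗ λ u → sum-cong-≗ λ v → cong₂ _*_ (q u) (cong₂ _*_ (p u v) (r v))

    form-mono : (∀ u v → M u v ≤ M′ u v) →
                (∀ u → f u ≤ f′ u) → (∀ u → g u ≤ g′ u) → form M f g ≤ form M′ f′ g′
    form-mono p q r = sum-mono λ u → sum-mono λ v → *-mono-≤ (q u) (*-mono-≤ (p u v) (r v))

    form-+ˡ : form M (λ u → f u + h u) g ≡ form M f g + form M h g
    form-+ˡ {M = M} {f} {h} {g} = trans (sum-cong-≗ λ u → trans (sum-cong-≗ λ v → *-distribʳ-+ (M u v * g v) (f u) (h u)) (∑-distrib-+ (λ v → f u * (M u v * g v)) (λ v → h u * (M u v * g v))))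
      (∑-distrib-+ (λ u → sum λ v → f u * (M u v * g v)) (λ u → sum λ v → h u * (M u v * g v)))

    form-swap : Symmetric M → form M f g ≡ form M g f
    form-swap {M = M} {f} {g} s = trans (∑-comm (λ u v → f u * (M u v * g v)))
      (sum-cong-≗ λ v → sum-cong-≗ λ u → trans (reorder (f u) (M u v) (g v)) (cong (λ x → g v * (x * f u)) (s u v)))
      where
      reorder : ∀ a b c → a * (b * c) ≡ c * (b * a)
      reorder = solve-∀

    form-+ʳ : form M f (λ u → g u + h u) ≡ form M f g + form M f h
    form-+ʳ {M = M} {f} {g} {h} = trans (sum-cong-≗ λ u → trans (sum-cong-≗ λ v → e (f u) (M u v) (g v) (h v)) (∑-distrib-+ (λ v → f u * (M u v * g v)) (λ v → f u * (M u v * h v))))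
      (∑-distrib-+ (λ u → sum λ v → f u * (M u v * g v)) (λ u → sum λ v → f u * (M u v * h v)))
      where
      e : ∀ a b c d → a * (b * (c + d)) ≡ a * (b * c) + a * (b * d)
      e = solve-∀

    form-rows : form M f g ≡ sum λ u → f u * sum λ v → M u v * g v
    form-rows {M = M} {f} {g} = sum-cong-≗ λ u → sym (*-distribˡ-sum (f u) (λ v → M u v * g v))

    form-+ : form (λ u v → M u v + M′ u v) f g ≡ form M f g + form M′ f g
    form-+ {M = M} {M′} {f} {g} = trans (sum-cong-≗ λ u → trans (sum-cong-≗ λ v → e (f u) (M u v) (M′ u v) (g v)) (∑-distrib-+ (λ v → f u * (M u v * g v)) (λ v → f u * (M′ u v * g v))))
        (∑-distrib-+ (λ u → sum λ v → f u * (M u v * g v)) (λ u → sum λ v → f u * (M′ u v * g v)))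
      where
      e : ∀ a b c d → a * ((b + c) * d) ≡ a * (b * d) + a * (c * d)
      e = solve-∀

-- Cuts as values of bilinear forms.

χ : (Fin n → Bool) → Fin n → ℕ
χ X u = ⟦ X u ⟧

∁ : (Fin n → Bool) → Fin n → Bool
∁ X u = not (X u)

χ+χ∁ : (X : Fin n → Bool) (u : Fin n) → χ X u + χ (∁ X) u ≡ 1
χ+χ∁ X u with X u
... | true  = refl
... | false = refl

⟦∧⟧ : ∀ a b → ⟦ a ∧ b ⟧ ≡ ⟦ a ⟧ * ⟦ b ⟧
⟦∧⟧ true  b = sym (+-identityʳ _)
⟦∧⟧ false b = refl

edges : Graph n → Matrix n
edges G u v = ⟦ adj G u v ⟧

edges-sym : (G : Graph n) → Symmetric (edges G)
edges-sym G u v = cong ⟦_⟧ (Graph.sym G u v)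

cutVal : Matrix n → (Fin n → Bool) → ℕ
cutVal M X = form M (χ X) (χ (∁ X))

private
  length-filter-map : ∀ {A B : Set} {P : B → Set} (P? : Decidable P) (f : A → B) (xs : List A) →
                      length (filter P? (List.map f xs)) ≡ length (filter (λ x → P? (f x)) xs)
  length-filter-map P? f [] = refl
  length-filter-map P? f (x ∷ xs) with does (P? (f x))
  ... | true  = cong suc (length-filter-map P? f xs)
  ... | false = length-filter-map P? f xs

  length-filter-tabulate : ∀ {A : Set} {P : A → Set} (P? : Decidable P) (f : Fin n → A) →
                           length (filter P? (List.tabulate f)) ≡ sum (λ i → ⟦ does (P? (f i)) ⟧)
  length-filter-tabulate {zero} P? f = refl
  length-filter-tabulate {suc n} P? f with does (P? (f zero))
  ... | true  = cong suc (length-filter-tabulate P? (f ∘ suc))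
  ... | false = length-filter-tabulate P? (f ∘ suc)

  length-filter-product : ∀ {m} {A B : Set} {P : A × B → Set} (P? : Decidable P) (f : Fin n → A) (g : Fin m → B) →
                          length (filter P? (cartesianProduct (List.tabulate f) (List.tabulate g)))
                          ≡ sum (λ i → sum (λ j → ⟦ does (P? (f i , g j)) ⟧))
  length-filter-product {zero} P? f g = refl
  length-filter-product {suc n} P? f g = begin
    length (filter P? (List.map (f zero ,_) (List.tabulate g) ++ rest))
      ≡⟨ cong length (filter-++ P? (List.map (f zero ,_) (List.tabulate g)) rest) ⟩
    length (filter P? (List.map (f zero ,_) (List.tabulate g)) ++ filter P? rest)
      ≡⟨ length-++ (filter P? (List.map (f zero ,_) (List.tabulate g))) ⟩
    length (filter P? (List.map (f zero ,_) (List.tabulate g))) + length (filter P? rest)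
      ≡⟨ cong₂ _+_ (trans (length-filter-map P? (f zero ,_) (List.tabulate g)) (length-filter-tabulate (λ y → P? (f zero , y)) g)) (length-filter-product P? (f ∘ suc) g) ⟩
    _ ∎
    where
    open ≡-Reasoning
    rest = cartesianProduct (List.tabulate (f ∘ suc)) (List.tabulate g)

  isLt-true : {u v : Fin n} → u Fin.< v → isLt u v ≡ true
  isLt-true {u = u} {v} p with u Fin.<? v
  ... | yes _ = refl
  ... | no ¬p = contradiction p ¬p

  isLt-false : {u v : Fin n} → ¬ (u Fin.< v) → isLt u v ≡ false
  isLt-false {u = u} {v} ¬p with u Fin.<? v
  ... | yes p = contradiction p ¬p
  ... | no _  = refl

  one-orientation : (G : Graph n) (u v : Fin n) (x : ℕ) →
                    ⟦ isLt u v ⟧ * (edges G u v * x) + ⟦ isLt v u ⟧ * (edges G u v * x) ≡ edges G u v * x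
  one-orientation G u v x with Fin.<-cmp u v
  ... | tri< p _ q rewrite isLt-true p | isLt-false q = trans (+-identityʳ _) (+-identityʳ _)
  ... | tri≈ _ refl _ rewrite irrefl G u | *-zeroʳ ⟦ isLt u u ⟧ = refl
  ... | tri> q _ p rewrite isLt-true p | isLt-false q = +-identityʳ _

  crossing : ∀ l a s t → ⟦ l ∧ a ∧ xor s t ⟧ ≡ ⟦ l ⟧ * (⟦ a ⟧ * (⟦ s ⟧ * ⟦ not t ⟧)) + ⟦ l ⟧ * (⟦ a ⟧ * (⟦ t ⟧ * ⟦ not s ⟧))
  crossing false a     s     t     = refl
  crossing true  false s     t     = refl
  crossing true  true  true  true  = refl
  crossing true  true  true  false = refl
  crossing true  true  false true  = refl
  crossing true  true  false false = refl

-- The left side runs over pairs `u < v`, the right side over ordered pairs. Splitting xor into its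
-- two directions and exchanging the variables in one of them leaves both orders of each pair, and
-- these recombine to the full sum because the diagonal of `adj` vanishes.
cut≡cutVal : (G : Graph n) (S : Subset n) → cut G S ≡ cutVal (edges G) (lookup S)
cut≡cutVal {n} G S = begin
  cut G S
    ≡⟨ length-filter-product {n} {n} _ id id ⟩
  sum (λ u → sum λ v → ⟦ isLt u v ∧ adj G u v ∧ xor (s u) (s v) ⟧)
    ≡⟨ (sum-cong-≗ λ u → trans (sum-cong-≗ λ v → crossing (isLt u v) (adj G u v) (s u) (s v))
          (∑-distrib-+ (λ v → ⟦ isLt u v ⟧ * (edges G u v * out u v)) (λ v → ⟦ isLt u v ⟧ * (edges G u v * out v u)))) ⟩
  sum (λ u → sum (λ v → ⟦ isLt u v ⟧ * (edges G u v * out u v)) + sum (λ v → ⟦ isLt u v ⟧ * (edges G u v * out v u)))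
    ≡⟨ ∑-distrib-+ (λ u → sum (λ v → ⟦ isLt u v ⟧ * (edges G u v * out u v))) (λ u → sum (λ v → ⟦ isLt u v ⟧ * (edges G u v * out v u))) ⟩
  sum (λ u → sum (λ v → ⟦ isLt u v ⟧ * (edges G u v * out u v))) + sum (λ u → sum (λ v → ⟦ isLt u v ⟧ * (edges G u v * out v u)))
    ≡⟨ cong (sum (λ u → sum (λ v → ⟦ isLt u v ⟧ * (edges G u v * out u v))) +_) (∑-comm (λ u v → ⟦ isLt u v ⟧ * (edges G u v * out v u))) ⟩
  sum (λ u → sum (λ v → ⟦ isLt u v ⟧ * (edges G u v * out u v))) + sum (λ u → sum (λ v → ⟦ isLt v u ⟧ * (edges G v u * out u v)))
    ≡⟨ ∑-distrib-+ (λ u → sum (λ v → ⟦ isLt u v ⟧ * (edges G u v * out u v))) (λ u → sum (λ v → ⟦ isLt v u ⟧ * (edges G v u * out u v))) ⟨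
  sum (λ u → sum (λ v → ⟦ isLt u v ⟧ * (edges G u v * out u v)) + sum (λ v → ⟦ isLt v u ⟧ * (edges G v u * out u v)))
    ≡⟨ (sum-cong-≗ λ u → trans (sym (∑-distrib-+ (λ v → ⟦ isLt u v ⟧ * (edges G u v * out u v)) (λ v → ⟦ isLt v u ⟧ * (edges G v u * out u v))))
         (sum-cong-≗ λ v → trans (cong (λ x → ⟦ isLt u v ⟧ * (edges G u v * out u v) + ⟦ isLt v u ⟧ * (x * out u v)) (edges-sym G v u))
           (trans (one-orientation G u v (out u v)) (reorder (edges G u v) ⟦ s u ⟧ ⟦ not (s v) ⟧)))) ⟩
  sum (λ u → sum λ v → ⟦ s u ⟧ * (edges G u v * ⟦ not (s v) ⟧))
    ≡⟨ form-def ⟨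
  cutVal (edges G) s ∎
  where
  open ≡-Reasoning
  s = lookup S
  out : Fin n → Fin n → ℕ
  out u v = ⟦ s u ⟧ * ⟦ not (s v) ⟧
  reorder : ∀ a b c → a * (b * c) ≡ b * (a * c)
  reorder = solve-∀

has : Bool → Vec Bool n → Bool
has b []           = false
has true  (c ∷ cs) = c ∨ has true cs
has false (c ∷ cs) = not c ∨ has false cs

-- The local functions of nontrivialᵇ have no name outside Defs; the left-hand sides of has-true and has-false
-- are therefore left to unification with the first equation.
mutual
  nontrivialᵇ-has : (S : Vec Bool n) → nontrivialᵇ S ≡ has true S ∧ has false S
  nontrivialᵇ-has [] = refl
  -- The local functions also take the enclosing arguments as parameters. Generalising over these
  -- keeps them fixed while the recursion descends along the tail.
  nontrivialᵇ-has {suc n} (b ∷ S) with suc n | b ∷ S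
  ... | m | S′ = cong₂ (λ p q → (b ∨ p) ∧ (not b ∨ q)) (has-true m S′ S) (has-false m S′ S)

  has-true : ∀ m (S′ : Vec Bool m) (S : Vec Bool n) → _ ≡ has true S
  has-true m S′ []      = refl
  has-true m S′ (b ∷ S) = cong (b ∨_) (has-true m S′ S)

  has-false : ∀ m (S′ : Vec Bool m) (S : Vec Bool n) → _ ≡ has false S
  has-false m S′ []      = refl
  has-false m S′ (b ∷ S) = cong (not b ∨_) (has-false m S′ S)

-- Failure probabilities

ℕ→ℚ-+ : ∀ a b → ℕ→ℚ (a + b) ≡ ℕ→ℚ a +q ℕ→ℚ b
ℕ→ℚ-+ a b = ℚ.toℚᵘ-injective (begin
  toℚᵘ (ℕ→ℚ (a + b))                       ≈⟨ ℚ.toℚᵘ-fromℚᵘ (mkℚᵘ (ℤ.+ (a + b)) 0) ⟩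
  mkℚᵘ (ℤ.+ (a + b)) 0                     ≈⟨ *≡* (cong (ℤ._* ℤ.+ 1) (trans (ℤ.pos-+ a b) (sym (cong₂ ℤ._+_ (ℤ.*-identityʳ (ℤ.+ a)) (ℤ.*-identityʳ (ℤ.+ b)))))) ⟩
  mkℚᵘ (ℤ.+ a) 0 ℚᵘ.+ mkℚᵘ (ℤ.+ b) 0       ≈⟨ ℚᵘ.+-cong (ℚ.toℚᵘ-fromℚᵘ (mkℚᵘ (ℤ.+ a) 0)) (ℚ.toℚᵘ-fromℚᵘ (mkℚᵘ (ℤ.+ b) 0)) ⟨
  toℚᵘ (ℕ→ℚ a) ℚᵘ.+ toℚᵘ (ℕ→ℚ b)           ≈⟨ ℚ.toℚᵘ-homo-+ (ℕ→ℚ a) (ℕ→ℚ b) ⟨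
  toℚᵘ (ℕ→ℚ a +q ℕ→ℚ b)                    ∎)
  where open import Relation.Binary.Reasoning.Setoid ℚᵘ.≃-setoid

ℕ→ℚ-* : ∀ a b → ℕ→ℚ (a * b) ≡ ℕ→ℚ a *q ℕ→ℚ b
ℕ→ℚ-* a b = ℚ.toℚᵘ-injective (begin
  toℚᵘ (ℕ→ℚ (a * b))                       ≈⟨ ℚ.toℚᵘ-fromℚᵘ (mkℚᵘ (ℤ.+ (a * b)) 0) ⟩
  mkℚᵘ (ℤ.+ (a * b)) 0                     ≈⟨ *≡* (cong (ℤ._* ℤ.+ 1) (ℤ.pos-* a b)) ⟩
  mkℚᵘ (ℤ.+ a) 0 ℚᵘ.* mkℚᵘ (ℤ.+ b) 0       ≈⟨ ℚᵘ.*-cong (ℚ.toℚᵘ-fromℚᵘ (mkℚᵘ (ℤ.+ a) 0)) (ℚ.toℚᵘ-fromℚᵘ (mkℚᵘ (ℤ.+ b) 0)) ⟨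
  toℚᵘ (ℕ→ℚ a) ℚᵘ.* toℚᵘ (ℕ→ℚ b)           ≈⟨ ℚ.toℚᵘ-homo-* (ℕ→ℚ a) (ℕ→ℚ b) ⟨
  toℚᵘ (ℕ→ℚ a *q ℕ→ℚ b)                    ∎)
  where open import Relation.Binary.Reasoning.Setoid ℚᵘ.≃-setoid

ℕ→ℚ-≤ : ∀ {a b} → a ≤ b → ℕ→ℚ a ≤q ℕ→ℚ b
ℕ→ℚ-≤ {a} {b} p = ℚ.toℚᵘ-cancel-≤ (begin
  toℚᵘ (ℕ→ℚ a)    ≃⟨ ℚ.toℚᵘ-fromℚᵘ (mkℚᵘ (ℤ.+ a) 0) ⟩
  mkℚᵘ (ℤ.+ a) 0  ≤⟨ *≤* (ℤ.*-monoʳ-≤-nonNeg (ℤ.+ 1) (ℤ.+≤+ p)) ⟩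
  mkℚᵘ (ℤ.+ b) 0  ≃⟨ ℚ.toℚᵘ-fromℚᵘ (mkℚᵘ (ℤ.+ b) 0) ⟨
  toℚᵘ (ℕ→ℚ b)    ∎)
  where open ℚᵘ.≤-Reasoning

ℕ→ℚ-nonNeg : ∀ a → NonNegative (ℕ→ℚ a)
ℕ→ℚ-nonNeg a = ℚ.nonNegative (ℕ→ℚ-≤ {0} {a} z≤n)

ℕ→ℚ-pos : ∀ a → Positive (ℕ→ℚ (suc a))
ℕ→ℚ-pos a = ℚ.positive (ℚ.<-≤-trans (ℚ.positive⁻¹ 1ℚ) (ℕ→ℚ-≤ {1} {suc a} (s≤s z≤n)))

-- F ≤ (1 − s / D) y, cleared of denominators and subtractions.
record FailsBy (D s : ℕ) (F y : ℚ) : Set where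
  constructor failsBy
  field fails-bound : ℕ→ℚ D *q F +q ℕ→ℚ s *q y ≤q ℕ→ℚ D *q y
open FailsBy public

module _ where
  open ℚ.≤-Reasoning
  open Data.Rational.Solver.+-*-Solver

  failsBy-¬ : ∀ {D F y} → F ≤q y → FailsBy D 0 F y
  failsBy-¬ {D} {F} {y} p = failsBy (begin
    ℕ→ℚ D *q F +q 0ℚ *q y  ≡⟨ solve 3 (λ d f y → d :* f :+ con 0ℚ :* y := d :* f) refl (ℕ→ℚ D) F y ⟩
    ℕ→ℚ D *q F             ≤⟨ ℚ.*-monoˡ-≤-nonNeg (ℕ→ℚ D) {{ℕ→ℚ-nonNeg D}} p ⟩
    ℕ→ℚ D *q y             ∎)

  failsBy-0 : ∀ {D F y} → F ≤q 0ℚ → FailsBy D D F y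
  failsBy-0 {D} {F} {y} p = failsBy (begin
    ℕ→ℚ D *q F +q ℕ→ℚ D *q y   ≤⟨ ℚ.+-monoˡ-≤ (ℕ→ℚ D *q y) (ℚ.*-monoˡ-≤-nonNeg (ℕ→ℚ D) {{ℕ→ℚ-nonNeg D}} p) ⟩
    ℕ→ℚ D *q 0ℚ +q ℕ→ℚ D *q y  ≡⟨ solve 2 (λ d y → d :* con 0ℚ :+ d :* y := d :* y) refl (ℕ→ℚ D) y ⟩
    ℕ→ℚ D *q y                 ∎)

  failsBy-weaken : ∀ {D s t F y} → 0ℚ ≤q y → s ≤ t → FailsBy D t F y → FailsBy D s F y
  failsBy-weaken {D} {s} {t} {F} {y} y≥0 p b = failsBy (ℚ.≤-trans
    (ℚ.+-monoʳ-≤ (ℕ→ℚ D *q F) (ℚ.*-monoʳ-≤-nonNeg y {{ℚ.nonNegative y≥0}} (ℕ→ℚ-≤ p))) (fails-bound b))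

  -- One fair coin. Doubling the denominator lets the numerators add without any division.
  failsBy-average : ∀ {D s t F G y} → FailsBy D s F y → FailsBy D t G y → FailsBy (2 * D) (s + t) (½ *q (F +q G)) y
  failsBy-average {D} {s} {t} {F} {G} {y} b c = failsBy (begin
    ℕ→ℚ (2 * D) *q (½ *q (F +q G)) +q ℕ→ℚ (s + t) *q y
      ≡⟨ cong₂ (λ d e → d *q (½ *q (F +q G)) +q e *q y) (ℕ→ℚ-* 2 D) (ℕ→ℚ-+ s t) ⟩
    (ℕ→ℚ 2 *q ℕ→ℚ D) *q (½ *q (F +q G)) +q (ℕ→ℚ s +q ℕ→ℚ t) *q y
      ≡⟨ solve 6 (λ d f g s t y → (con (ℕ→ℚ 2) :* d) :* (con ½ :* (f :+ g)) :+ (s :+ t) :* y := (d :* f :+ s :* y) :+ (d :* g :+ t :* y)) refl (ℕ→ℚ D) F G (ℕ→ℚ s) (ℕ→ℚ t) y ⟩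
    (ℕ→ℚ D *q F +q ℕ→ℚ s *q y) +q (ℕ→ℚ D *q G +q ℕ→ℚ t *q y)
      ≤⟨ ℚ.+-mono-≤ (fails-bound b) (fails-bound c) ⟩
    ℕ→ℚ D *q y +q ℕ→ℚ D *q y
      ≡⟨ solve 2 (λ d y → d :* y :+ d :* y := (con (ℕ→ℚ 2) :* d) :* y) refl (ℕ→ℚ D) y ⟩
    (ℕ→ℚ 2 *q ℕ→ℚ D) *q y
      ≡⟨ cong (_*q y) (ℕ→ℚ-* 2 D) ⟨
    ℕ→ℚ (2 * D) *q y ∎)

  failsBy-cancel : ∀ {D s F y} c .{{_ : NonZero c}} → FailsBy (c * D) (c * s) F y → FailsBy D s F y
  failsBy-cancel {D} {s} {F} {y} c@(suc c′) b = failsBy (ℚ.*-cancelˡ-≤-pos (ℕ→ℚ c) {{ℕ→ℚ-pos c′}} (begin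
    ℕ→ℚ c *q (ℕ→ℚ D *q F +q ℕ→ℚ s *q y)
      ≡⟨ solve 5 (λ c d f s y → c :* (d :* f :+ s :* y) := (c :* d) :* f :+ (c :* s) :* y) refl (ℕ→ℚ c) (ℕ→ℚ D) F (ℕ→ℚ s) y ⟩
    (ℕ→ℚ c *q ℕ→ℚ D) *q F +q (ℕ→ℚ c *q ℕ→ℚ s) *q y
      ≡⟨ cong₂ (λ d e → d *q F +q e *q y) (ℕ→ℚ-* c D) (ℕ→ℚ-* c s) ⟨
    ℕ→ℚ (c * D) *q F +q ℕ→ℚ (c * s) *q y
      ≤⟨ fails-bound b ⟩
    ℕ→ℚ (c * D) *q y
      ≡⟨ cong (_*q y) (ℕ→ℚ-* c D) ⟩
    (ℕ→ℚ c *q ℕ→ℚ D) *q y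
      ≡⟨ ℚ.*-assoc (ℕ→ℚ c) (ℕ→ℚ D) y ⟩
    ℕ→ℚ c *q (ℕ→ℚ D *q y) ∎))

  failsBy⇒≤ : ∀ {D F y} .{{_ : NonZero D}} → FailsBy D 0 F y → F ≤q y
  failsBy⇒≤ {D@(suc D′)} {F} {y} b = ℚ.*-cancelˡ-≤-pos (ℕ→ℚ D) {{ℕ→ℚ-pos D′}} (begin
    ℕ→ℚ D *q F             ≡⟨ solve 3 (λ d f y → d :* f := d :* f :+ con 0ℚ :* y) refl (ℕ→ℚ D) F y ⟩
    ℕ→ℚ D *q F +q 0ℚ *q y  ≤⟨ fails-bound b ⟩
    ℕ→ℚ D *q y             ∎)

-- Uniform samples from fair coins.

Σ< : ℕ → (ℕ → ℕ) → ℕ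
Σ< zero    f = 0
Σ< (suc k) f = Σ< k f + f k

Σ<-cong : ∀ k {f g} → (∀ i → i < k → f i ≡ g i) → Σ< k f ≡ Σ< k g
Σ<-cong zero    p = refl
Σ<-cong (suc k) p = cong₂ _+_ (Σ<-cong k λ i i<k → p i (m<n⇒m<1+n i<k)) (p k ≤-refl)

Σ<-split : ∀ a b f → Σ< (a + b) f ≡ Σ< a f + Σ< b (λ i → f (a + i))
Σ<-split a zero    f = trans (cong (λ k → Σ< k f) (+-identityʳ a)) (sym (+-identityʳ _))
Σ<-split a (suc b) f = trans (cong (λ k → Σ< k f) (+-suc a b))
  (trans (cong (_+ f (a + b)) (Σ<-split a b f)) (+-assoc (Σ< a f) _ _))

Σ<-≤ : ∀ {a b} f → a ≤ b → Σ< a f ≤ Σ< b f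
Σ<-≤ {a} {b} f p with m≤n⇒∃[o]m+o≡n p
... | c , refl = subst (Σ< a f ≤_) (sym (Σ<-split a c f)) (m≤m+n _ _)

Σ<-const : ∀ k c → Σ< k (λ _ → c) ≡ k * c
Σ<-const zero    c = refl
Σ<-const (suc k) c = trans (cong (_+ c) (Σ<-const k c)) (+-comm _ c)

Σ<-+ : ∀ k f g → Σ< k (λ i → f i + g i) ≡ Σ< k f + Σ< k g
Σ<-+ zero    f g = refl
Σ<-+ (suc k) f g = trans (cong (_+ (f k + g k)) (Σ<-+ k f g)) (e (Σ< k f) (Σ< k g) (f k) (g k))
  where
  e : ∀ a b c d → a + b + (c + d) ≡ a + c + (b + d)
  e = solve-∀

Σ<-*ʳ : ∀ k f c → Σ< k (λ i → f i * c) ≡ Σ< k f * c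
Σ<-*ʳ zero    f c = refl
Σ<-*ʳ (suc k) f c = trans (cong (_+ f k * c) (Σ<-*ʳ k f c)) (sym (*-distribʳ-+ c (Σ< k f) (f k)))

-- The coins are the binary digits of a uniform number below `2 ^ m`. All randomness of the
-- algorithm enters here.
sample : ℕ → (ℕ → Alg n) → Alg n
sample zero    k = k 0
sample (suc m) k = coin λ b → sample m λ r → k ((if b then 0 else 2 ^ m) + r)

-- Linearity of expectation: the success `w r / D` may differ from outcome to outcome, and only the
-- sum of the numerators matters.
sample-fails : ∀ {G : Graph n} {D y} m {w : ℕ → ℕ} {k : ℕ → Alg n} → (∀ r → FailsBy D (w r) (failProb G (k r)) y) →
               FailsBy (2 ^ m * D) (Σ< (2 ^ m) w) (failProb G (sample m k)) y
sample-fails {D = D} {y} zero {w} h = subst (λ d → FailsBy d (w 0) _ y) (sym (+-identityʳ D)) (h 0)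
sample-fails {G = G} {D} {y} (suc m) {w} {k} h =
  subst₂ (λ d s → FailsBy d s (failProb G (sample (suc m) k)) y) (sym (*-assoc 2 (2 ^ m) D))
    (sym (trans (cong (λ j → Σ< (2 ^ m + j) w) (+-identityʳ (2 ^ m))) (Σ<-split (2 ^ m) (2 ^ m) w)))
    (failsBy-average (sample-fails m λ r → h r) (sample-fails m λ r → h (2 ^ m + r)))

sample-queries : ∀ {G : Graph n} {t} m {k : ℕ → Alg n} → (∀ r → queries G (k r) ≤ t) → queries G (sample m k) ≤ t
sample-queries zero    h = h 0
sample-queries (suc m) h = ⊔-lub (sample-queries m λ r → h r) (sample-queries m λ r → h (2 ^ m + r))

-- `M` is rounded up to whole periods, so every residue occurs at most `suc (M / d)` times. Compared
-- with a uniform residue, this costs the factor `1 + d / M`.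
Σ<-mod : ∀ M d .{{_ : NonZero d}} (f : ℕ → ℕ) → d * Σ< M (λ r → f (r % d)) ≤ (M + d) * Σ< d f
Σ<-mod M d f = begin
  d * Σ< M periodic                 ≤⟨ *-monoʳ-≤ d (Σ<-≤ periodic (subst (_≤ q * d + d) (sym (m≡m%n+[m/n]*n M d)) (subst (M % d + q * d ≤_) (+-comm d (q * d)) (+-monoˡ-≤ (q * d) (m%n≤n M d))))) ⟩
  d * Σ< (q * d + d) periodic       ≡⟨ cong (λ k → d * Σ< k periodic) (+-comm (q * d) d) ⟩
  d * Σ< (suc q * d) periodic       ≡⟨ cong (d *_) (blocks (suc q)) ⟩
  d * (suc q * Σ< d f)              ≡⟨ *-assoc d (suc q) (Σ< d f) ⟨
  d * suc q * Σ< d f                ≤⟨ *-monoˡ-≤ (Σ< d f) (subst (_≤ M + d) (e q d) (+-monoˡ-≤ d (m/n*n≤m M d))) ⟩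
  (M + d) * Σ< d f                  ∎
  where
  open ≤-Reasoning
  q = M / d
  periodic = λ r → f (r % d)
  e : ∀ q d → q * d + d ≡ d * suc q
  e = solve-∀
  blocks : ∀ q → Σ< (q * d) periodic ≡ q * Σ< d f
  blocks zero    = refl
  blocks (suc q) = trans (Σ<-split d (q * d) periodic) (cong₂ _+_
    (Σ<-cong d λ i i<d → cong f (m<n⇒m%n≡m i<d))
    (trans (Σ<-cong (q * d) λ i _ → cong f (trans (cong (_% d) (+-comm d i)) ([m+n]%n≡m%n i d))) (blocks q)))

-- Binary search for vertices and edges

-- A subroutine returning an A, in continuation-passing style; Computes holds for those that flip no coins.
Routine : ℕ → Set → Set
Routine n A = (A → Alg n) → Alg n

record Computes (G : Graph n) {A : Set} (p : Routine n A) (t : ℕ) (v : A) : Set where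
  field
    cost : ∀ k → queries G (p k) ≤ t + queries G (k v)
    fail : ∀ k → failProb G (p k) ≡ failProb G (k v)
open Computes public

computes-return : ∀ {G : Graph n} {A : Set} {v : A} → Computes G (λ k → k v) 0 v
computes-return = record { cost = λ _ → ≤-refl ; fail = λ _ → refl }

computes-bind : ∀ {G : Graph n} {A B : Set} (p : Routine n A) (q : A → Routine n B) {s t v w} →
                Computes G p s v → Computes G (q v) t w → Computes G (λ k → p λ a → q a k) (s + t) w
computes-bind {G = G} p q {s} {t} {v} {w} c d = record
  { cost = λ k → ≤-trans (cost c λ a → q a k) (≤-trans (+-monoʳ-≤ s (cost d k)) (≤-reflexive (sym (+-assoc s t _))))
  ; fail = λ k → trans (fail c λ a → q a k) (fail d k) }

computes-weaken : ∀ {G : Graph n} {A : Set} {p : Routine n A} {s t v} → s ≤ t → Computes G p s v → Computes G p t v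
computes-weaken s≤t c = record { cost = λ k → ≤-trans (cost c k) (+-monoˡ-≤ _ s≤t) ; fail = fail c }

cutVal-cong : ∀ (M : Matrix n) {X Y : Fin n → Bool} → (∀ u → X u ≡ Y u) → cutVal M X ≡ cutVal M Y
cutVal-cong M p = form-cong {M = M} (λ _ _ → refl) (λ u → cong ⟦_⟧ (p u)) (λ u → cong (⟦_⟧ ∘ not) (p u))

askCut : (Fin n → Bool) → Routine n ℕ
askCut X = query (tabulate X)

askCut-computes : ∀ {G : Graph n} X → Computes G (askCut X) 1 (cutVal (edges G) X)
askCut-computes {G = G} X = record
  { cost = λ k → ≤-reflexive (cong (suc ∘ queries G ∘ k) e)
  ; fail = λ k → cong (failProb G ∘ k) e }
  where
  e : cut G (tabulate X) ≡ cutVal (edges G) X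
  e = trans (cut≡cutVal G (tabulate X)) (cutVal-cong (edges G) (lookup∘tabulate X))

-- For disjoint `A` and `B`, the sum of their cuts exceeds the cut of the union by twice the number
-- of edges between them.
askBetween : (A B : Fin n → Bool) → Routine n ℕ
askBetween A B k = askCut A λ a → askCut B λ b → askCut (λ u → A u ∨ B u) λ c → k ⌊ a + b ∸ c /2⌋

between : Graph n → (A B : Fin n → Bool) → ℕ
between G A B = ⌊ cutVal (edges G) A + cutVal (edges G) B ∸ cutVal (edges G) (λ u → A u ∨ B u) /2⌋

askBetween-computes : ∀ {G : Graph n} A B → Computes G (askBetween A B) 3 (between G A B)
askBetween-computes A B = computes-bind (askCut A) _ (askCut-computes A) (computes-bind (askCut B) _ (askCut-computes B)
  (computes-bind (askCut λ u → A u ∨ B u) (λ c k → k _) (askCut-computes λ u → A u ∨ B u) computes-return))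

Disjoint : (A B : Fin n → Bool) → Set
Disjoint A B = ∀ u → A u ∧ B u ≡ false

between≡form : ∀ (G : Graph n) {A B} → Disjoint A B → between G A B ≡ form (edges G) (χ A) (χ B)
between≡form {n} G {A} {B} dis = begin
  ⌊ cutVal M A + cutVal M B ∸ cutVal M A∪B /2⌋  ≡⟨ cong (λ x → ⌊ x ∸ cutVal M A∪B /2⌋) eq ⟩
  ⌊ (ab + ab) + cutVal M A∪B ∸ cutVal M A∪B /2⌋  ≡⟨ cong ⌊_/2⌋ (m+n∸n≡m (ab + ab) (cutVal M A∪B)) ⟩
  ⌊ ab + ab /2⌋                                 ≡⟨ n≡⌊n+n/2⌋ ab ⟨
  ab                                            ∎
  where
  open ≡-Reasoning
  M = edges G
  A∪B : Fin n → Bool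
  A∪B u = A u ∨ B u
  ab = form M (χ A) (χ B)
  r : Fin n → ℕ
  r = χ (∁ A∪B)
  split : ∀ a b → a ∧ b ≡ false → ⟦ not a ⟧ ≡ ⟦ b ⟧ + ⟦ not (a ∨ b) ⟧
  split true  false e = refl
  split false true  e = refl
  split false false e = refl
  split′ : ∀ a b → a ∧ b ≡ false → ⟦ not b ⟧ ≡ ⟦ a ⟧ + ⟦ not (a ∨ b) ⟧
  split′ true  false e = refl
  split′ false true  e = refl
  split′ false false e = refl
  join : ∀ a b → a ∧ b ≡ false → ⟦ a ∨ b ⟧ ≡ ⟦ a ⟧ + ⟦ b ⟧
  join true  false e = refl
  join false true  e = refl
  join false false e = refl
  eqA : cutVal M A ≡ ab + form M (χ A) r
  eqA = trans (form-cong {M = M} (λ _ _ → refl) (λ _ → refl) (λ u → split (A u) (B u) (dis u))) form-+ʳ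
  eqB : cutVal M B ≡ ab + form M (χ B) r
  eqB = trans (form-cong {M = M} (λ _ _ → refl) (λ _ → refl) (λ u → split′ (A u) (B u) (dis u)))
          (trans form-+ʳ (cong (_+ form M (χ B) r) (form-swap (edges-sym G))))
  eqAB : cutVal M A∪B ≡ form M (χ A) r + form M (χ B) r
  eqAB = trans (form-cong {M = M} (λ _ _ → refl) (λ u → join (A u) (B u) (dis u)) (λ _ → refl)) form-+ˡ
  arith : ∀ x y z → (x + y) + (x + z) ≡ (x + x) + (y + z)
  arith = solve-∀
  eq : cutVal M A + cutVal M B ≡ (ab + ab) + cutVal M A∪B
  eq = trans (cong₂ _+_ eqA eqB) (trans (arith ab _ _) (cong ((ab + ab) +_) (sym eqAB)))

search : (ℕ → Routine n ℕ) → ℕ → ℕ → ℕ → Routine n ℕ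
search ask zero    lo i k = k lo
search ask (suc m) lo i k = ask (lo + 2 ^ m) λ x → if i <ᵇ x then search ask m lo i k else search ask m (lo + 2 ^ m) i k

-- The position that `search` reaches when the answers are the values of `P`. It separates the
-- correctness of the search from its queries.
locate : (ℕ → ℕ) → ℕ → ℕ → ℕ → ℕ
locate P zero    lo i = lo
locate P (suc m) lo i = if i <ᵇ P (lo + 2 ^ m) then locate P m lo i else locate P m (lo + 2 ^ m) i

search-computes : ∀ {G : Graph n} {ask P c} → (∀ t → Computes G (ask t) c (P t)) →
                  ∀ m lo i → Computes G (search ask m lo i) (m * c) (locate P m lo i)
search-computes h zero lo i = record { cost = λ k → ≤-refl ; fail = λ k → refl }
search-computes {G = G} {ask} {P} {c} h (suc m) lo i = record { cost = co ; fail = fa }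
  where
  co : ∀ k → queries G (search ask (suc m) lo i k) ≤ (c + m * c) + queries G (k (locate P (suc m) lo i))
  co k with cost (h (lo + 2 ^ m)) (λ x → if i <ᵇ x then search ask m lo i k else search ask m (lo + 2 ^ m) i k)
  ... | p with i <ᵇ P (lo + 2 ^ m)
  ... | true  = ≤-trans p (≤-trans (+-monoʳ-≤ c (cost (search-computes h m lo i) k)) (≤-reflexive (sym (+-assoc c (m * c) _))))
  ... | false = ≤-trans p (≤-trans (+-monoʳ-≤ c (cost (search-computes h m (lo + 2 ^ m) i) k)) (≤-reflexive (sym (+-assoc c (m * c) _))))
  fa : ∀ k → failProb G (search ask (suc m) lo i k) ≡ failProb G (k (locate P (suc m) lo i))
  fa k with fail (h (lo + 2 ^ m)) (λ x → if i <ᵇ x then search ask m lo i k else search ask m (lo + 2 ^ m) i k)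
  ... | p with i <ᵇ P (lo + 2 ^ m)
  ... | true  = trans p (fail (search-computes h m lo i) k)
  ... | false = trans p (fail (search-computes h m (lo + 2 ^ m) i) k)

-- Each halving keeps `P lo ≤ i < P (lo + 2 ^ m)`; at width one this is the conclusion.
locate-spec : ∀ (P : ℕ → ℕ) m lo i → P lo ≤ i → i < P (lo + 2 ^ m) → P (locate P m lo i) ≤ i × i < P (suc (locate P m lo i))
locate-spec P zero lo i p q = p , subst (λ t → i < P t) (+-comm lo 1) q
locate-spec P (suc m) lo i p q with i <ᵇ P (lo + 2 ^ m) in eq
... | true  = locate-spec P m lo i p (<ᵇ⇒< i _ (subst T (sym eq) _))
... | false = locate-spec P m (lo + 2 ^ m) i (≮⇒≥ λ lt → subst T eq (<⇒<ᵇ lt))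
                (subst (λ t → i < P t) (trans (cong (lo +_) (cong (2 ^ m +_) (+-identityʳ (2 ^ m)))) (sym (+-assoc lo (2 ^ m) (2 ^ m)))) q)

⟦⟧-mono : ∀ a b → (T a → T b) → ⟦ a ⟧ ≤ ⟦ b ⟧
⟦⟧-mono false b     p = z≤n
⟦⟧-mono true  true  p = ≤-refl
⟦⟧-mono true  false p = contradiction (p _) λ ()

below : ℕ → Fin n → Bool
below t u = toℕ u <ᵇ t

abstract
  prefix : (Fin n → ℕ) → ℕ → ℕ
  prefix q t = sum λ u → ⟦ below t u ⟧ * q u

  prefix-def : ∀ {q : Fin n → ℕ} {t} → prefix q t ≡ sum λ u → ⟦ below t u ⟧ * q u
  prefix-def = refl

  prefix-0 : (q : Fin n → ℕ) → prefix q 0 ≡ 0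
  prefix-0 {n} q = sum-zero {n} {λ u → ⟦ below 0 u ⟧ * q u} λ _ → refl

  prefix-all : ∀ (q : Fin n → ℕ) {t} → n ≤ t → prefix q t ≡ sum q
  prefix-all q {t} p = sum-cong-≗ λ u → trans (cong (λ b → ⟦ b ⟧ * q u) (T⇒true (<⇒<ᵇ (<-≤-trans (Fin.toℕ<n u) p)))) (+-identityʳ (q u))

  prefix-mono : ∀ (q : Fin n → ℕ) {s t} → s ≤ t → prefix q s ≤ prefix q t
  prefix-mono q {s} {t} p = sum-mono λ u → *-monoˡ-≤ (q u)
    (⟦⟧-mono (below s u) (below t u) λ lt → <⇒<ᵇ (<-≤-trans (<ᵇ⇒< (toℕ u) s lt) p))

  prefix-suc : ∀ (q : Fin n → ℕ) u → prefix q (suc (toℕ u)) ≡ prefix q (toℕ u) + q u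
  prefix-suc q zero = trans (cong₂ _+_ (+-identityʳ (q zero)) (sum-zero {f = λ u → ⟦ below 1 (suc u) ⟧ * q (suc u)} λ _ → refl))
    (trans (+-identityʳ (q zero)) (cong (_+ q zero) (sym (prefix-0 q))))
  prefix-suc q (suc u) = trans (cong (⟦ below (2 + toℕ u) (zero {toℕ u}) ⟧ * q zero +_) (prefix-suc (q ∘ suc) u)) (sym (+-assoc (1 * q zero) _ _))

-- The search interval has length a power of two and may reach past the last vertex; `d` stands for
-- the positions there. An index below the total weight never leads to them, as all weight lies
-- before position `n`.
clamp : Fin n → ℕ → Fin n
clamp {n} d t with t <? n
... | yes p = fromℕ< p
... | no _  = d

toℕ-clamp : ∀ (d : Fin n) {t} → t < n → toℕ (clamp d t) ≡ t
toℕ-clamp {n} d {t} p with t <? n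
... | yes p = Fin.toℕ-fromℕ< p
... | no ¬p = contradiction p ¬p

module _ (d : Fin n) (m : ℕ) where

  -- Inversion of the cumulative weight: each vertex `u` owns a block of `q u` consecutive indices.
  pick : (Fin n → ℕ) → ℕ → Fin n
  pick q i = clamp d (locate (prefix q) m 0 i)

  module _ (q : Fin n → ℕ) (n≤2^m : n ≤ 2 ^ m) where

    pick-spec : ∀ {i} → i < sum q → prefix q (toℕ (pick q i)) ≤ i × i < prefix q (toℕ (pick q i)) + q (pick q i)
    pick-spec {i} i<Σ with locate-spec (prefix q) m 0 i (≤-trans (≤-reflexive (prefix-0 q)) z≤n) (subst (i <_) (sym (prefix-all q n≤2^m)) i<Σ)
    ... | lo , hi = subst (λ s → prefix q s ≤ i) (sym e) lo , subst (i <_) (trans (cong (prefix q ∘ suc) (sym e)) (prefix-suc q (pick q i))) hi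
      where
      t = locate (prefix q) m 0 i
      e : toℕ (pick q i) ≡ t
      e = toℕ-clamp d (≰⇒> λ n≤t → <-irrefl refl (<-≤-trans i<Σ (subst (_≤ i) (prefix-all q n≤t) lo)))

    pick-positive : ∀ {i} → i < sum q → 0 < q (pick q i)
    pick-positive i<Σ with pick-spec i<Σ
    ... | lo , hi = +-cancelˡ-< (prefix q _) 0 _ (<-≤-trans (s≤s (≤-trans (≤-reflexive (+-identityʳ _)) lo)) hi)

    pick-unique : ∀ u {i} → i < q u → pick q (prefix q (toℕ u) + i) ≡ u
    pick-unique u {i} i<q with pick-spec {prefix q (toℕ u) + i} i′<Σ
      where
      i′<Σ : prefix q (toℕ u) + i < sum q
      i′<Σ = <-≤-trans (+-monoʳ-< (prefix q (toℕ u)) i<q)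
        (≤-trans (≤-reflexive (sym (prefix-suc q u))) (≤-trans (prefix-mono q (Fin.toℕ<n u)) (≤-reflexive (prefix-all q ≤-refl))))
    ... | lo , hi = Fin.toℕ-injective (≤-antisym (≮⇒≥ u<w) (≮⇒≥ w<u))
      where
      w = pick q (prefix q (toℕ u) + i)
      u<w : ¬ (toℕ u < toℕ w)
      u<w p = <-irrefl refl (<-≤-trans (+-monoʳ-< (prefix q (toℕ u)) i<q)
        (≤-trans (≤-reflexive (sym (prefix-suc q u))) (≤-trans (prefix-mono q p) lo)))
      w<u : ¬ (toℕ w < toℕ u)
      w<u p = <-irrefl refl (<-≤-trans hi
        (≤-trans (≤-reflexive (sym (prefix-suc q w))) (≤-trans (prefix-mono q p) (m≤m+n _ i))))

    -- The blocks of the vertices tile the indices below `sum q`, so a uniform index draws `u` with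
    -- probability proportional to `q u`.
    pick-count : (g : Fin n → ℕ) → Σ< (sum q) (g ∘ pick q) ≡ sum (λ u → q u * g u)
    pick-count g = begin
      Σ< (sum q) (g ∘ pick q)        ≡⟨ cong (λ k → Σ< k (g ∘ pick q)) (prefix-all q ≤-refl) ⟨
      Σ< (prefix q n) (g ∘ pick q)   ≡⟨ upto n ≤-refl ⟩
      prefix (λ u → q u * g u) n     ≡⟨ prefix-all (λ u → q u * g u) ≤-refl ⟩
      sum (λ u → q u * g u)          ∎
      where
      open ≡-Reasoning
      upto : ∀ t → t ≤ n → Σ< (prefix q t) (g ∘ pick q) ≡ prefix (λ u → q u * g u) t
      upto zero    _ = trans (cong (λ k → Σ< k (g ∘ pick q)) (prefix-0 q)) (sym (prefix-0 (λ u → q u * g u)))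
      upto (suc t) t<n = subst (λ t → Σ< (prefix q (suc t)) (g ∘ pick q) ≡ prefix (λ u → q u * g u) (suc t)) (Fin.toℕ-fromℕ< t<n) (begin
        Σ< (prefix q (suc (toℕ u))) (g ∘ pick q)
          ≡⟨ cong (λ k → Σ< k (g ∘ pick q)) (prefix-suc q u) ⟩
        Σ< (prefix q (toℕ u) + q u) (g ∘ pick q)
          ≡⟨ Σ<-split (prefix q (toℕ u)) (q u) (g ∘ pick q) ⟩
        Σ< (prefix q (toℕ u)) (g ∘ pick q) + Σ< (q u) (λ i → g (pick q (prefix q (toℕ u) + i)))
          ≡⟨ cong₂ _+_ (subst (λ s → Σ< (prefix q s) (g ∘ pick q) ≡ prefix (λ u → q u * g u) s) (sym (Fin.toℕ-fromℕ< t<n)) (upto t (<⇒≤ t<n)))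
               (trans (Σ<-cong (q u) λ i i<q → cong g (pick-unique u i<q)) (Σ<-const (q u) (g u))) ⟩
        prefix (λ u → q u * g u) (toℕ u) + q u * g u
          ≡⟨ prefix-suc (λ u → q u * g u) u ⟨
        prefix (λ u → q u * g u) (suc (toℕ u)) ∎)
        where u = fromℕ< t<n

-- Nontrivial sets, exhaustive minimisation and minimum cuts.

Nontrivial : (Fin n → Bool) → Set
Nontrivial X = (∃ λ u → X u ≡ true) × (∃ λ v → X v ≡ false)

∧-true : ∀ {a b} → a ∧ b ≡ true → a ≡ true × b ≡ true
∧-true {true} {true} _ = refl , refl

has-intro : ∀ b (S : Subset n) u → lookup S u ≡ b → has b S ≡ true
has-intro true  (true  ∷ S) zero    e = refl
has-intro false (false ∷ S) zero    e = refl
has-intro true  (c ∷ S)     (suc u) e = trans (cong (c ∨_) (has-intro true S u e)) (Bool.∨-zeroʳ c)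
has-intro false (c ∷ S)     (suc u) e = trans (cong (not c ∨_) (has-intro false S u e)) (Bool.∨-zeroʳ (not c))

has-elim : ∀ b (S : Subset n) → has b S ≡ true → ∃ λ u → lookup S u ≡ b
has-elim true  (true  ∷ S) e = zero , refl
has-elim true  (false ∷ S) e = let u , p = has-elim true S e in suc u , p
has-elim false (true  ∷ S) e = let u , p = has-elim false S e in suc u , p
has-elim false (false ∷ S) e = zero , refl
has-elim true  [] ()
has-elim false [] ()

nontrivialᵇ-intro : (S : Subset n) → Nontrivial (lookup S) → nontrivialᵇ S ≡ true
nontrivialᵇ-intro S ((u , p) , (v , q)) = trans (nontrivialᵇ-has S) (cong₂ _∧_ (has-intro true S u p) (has-intro false S v q))

nontrivialᵇ-elim : (S : Subset n) → nontrivialᵇ S ≡ true → Nontrivial (lookup S)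
nontrivialᵇ-elim S e with ∧-true (trans (sym (nontrivialᵇ-has S)) e)
... | p , q = has-elim true S p , has-elim false S q

∈-allSubsets : (S : Subset n) → S ∈ allSubsets n
∈-allSubsets []          = here refl
∈-allSubsets (true  ∷ S) = ∈-++⁺ˡ (∈-map⁺ (true ∷_) (∈-allSubsets S))
∈-allSubsets (false ∷ S) = ∈-++⁺ʳ (map (true ∷_) (allSubsets _)) (∈-map⁺ (false ∷_) (∈-allSubsets S))

allL-intro : ∀ {A : Set} (p : A → Bool) xs → (∀ x → p x ≡ true) → allL p xs ≡ true
allL-intro p []       h = refl
allL-intro p (x ∷ xs) h = cong₂ _∧_ (h x) (allL-intro p xs h)

module _ {A : Set} (p : A → Bool) (f : A → ℕ) where

  lighter : A → Maybe A → A
  lighter x nothing  = x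
  lighter x (just y) = if f x ≤ᵇ f y then x else y

  -- It serves the algorithm, for cuts of known edges and for smallest classes, and also the
  -- analysis, for the existence of a minimum cut.
  lightest : List A → Maybe A
  lightest []       = nothing
  lightest (x ∷ xs) = if p x then just (lighter x (lightest xs)) else lightest xs

  lightest-sat : ∀ xs {y} → lightest xs ≡ just y → p y ≡ true
  lightest-sat (x ∷ xs) e with p x in px | lightest xs in l
  lightest-sat (x ∷ xs) refl | true  | nothing = px
  lightest-sat (x ∷ xs) refl | true  | just y with f x ≤ᵇ f y
  ... | true  = px
  ... | false = lightest-sat xs l
  lightest-sat (x ∷ xs) refl | false | just y = lightest-sat xs l

  lightest-min : ∀ {x xs} → x ∈ xs → p x ≡ true → ∃ λ y → lightest xs ≡ just y × f y ≤ f x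
  lightest-min {x} {.x ∷ xs} (here refl) px rewrite px with lightest xs
  ... | nothing = x , refl , ≤-refl
  ... | just y with f x ≤ᵇ f y in e
  ... | true  = x , refl , ≤-refl
  ... | false = y , refl , <⇒≤ (≰⇒> λ le → subst T e (≤⇒≤ᵇ le))
  lightest-min {x} {z ∷ xs} (there x∈) px with lightest-min x∈ px
  ... | y , e , le with p z
  ... | false = y , e , le
  ... | true rewrite e with f z ≤ᵇ f y in e′
  ... | true  = z , refl , ≤-trans (≤ᵇ⇒≤ _ _ (subst T (sym e′) _)) le
  ... | false = y , refl , le

IsMinCut : Graph n → (Fin n → Bool) → Set
IsMinCut G X = Nontrivial X × (∀ Y → Nontrivial Y → cutVal (edges G) X ≤ cutVal (edges G) Y)

nontrivial-cong : {X Y : Fin n → Bool} → (∀ u → X u ≡ Y u) → Nontrivial X → Nontrivial Y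
nontrivial-cong e ((u , p) , (v , q)) = (u , trans (sym (e u)) p) , (v , trans (sym (e v)) q)

isMinCutᵇ-intro : (G : Graph n) (S : Subset n) → IsMinCut G (lookup S) → isMinCutᵇ G S ≡ true
isMinCutᵇ-intro {n} G S (nt , min) = cong₂ _∧_ (nontrivialᵇ-intro S nt) (allL-intro _ (allSubsets n) all)
  where
  all : ∀ U → not (nontrivialᵇ U) ∨ (cut G S ≤ᵇ cut G U) ≡ true
  all U with nontrivialᵇ U in e
  ... | false = refl
  ... | true  = T⇒true (≤⇒≤ᵇ (subst₂ _≤_ (sym (cut≡cutVal G S)) (sym (cut≡cutVal G U)) (min (lookup U) (nontrivialᵇ-elim U e))))

minCut-exists : (G : Graph n) {X : Fin n → Bool} → Nontrivial X → ∃ λ Y → IsMinCut G Y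
minCut-exists {n} G {X} nt = lookup (proj₁ (best X nt)) , nontrivialᵇ-elim (proj₁ (best X nt)) sat , λ Y ntY →
  subst (λ z → cutVal (edges G) (lookup z) ≤ cutVal (edges G) Y) (same Y ntY) (proj₂ (proj₂ (best Y ntY)))
  where
  best : ∀ Y → Nontrivial Y → ∃ λ y → lightest nontrivialᵇ (λ S → cutVal (edges G) (lookup S)) (allSubsets n) ≡ just y × cutVal (edges G) (lookup y) ≤ cutVal (edges G) Y
  best Y ntY with lightest-min nontrivialᵇ (λ S → cutVal (edges G) (lookup S)) (∈-allSubsets (tabulate Y))
                    (nontrivialᵇ-intro (tabulate Y) (nontrivial-cong (λ u → sym (lookup∘tabulate Y u)) ntY))
  ... | y , e , le = y , e , ≤-trans le (≤-reflexive (cutVal-cong (edges G) (lookup∘tabulate Y)))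
  sat = lightest-sat nontrivialᵇ (λ S → cutVal (edges G) (lookup S)) (allSubsets n) (proj₁ (proj₂ (best X nt)))
  -- `best` names its set anew for every competitor `Y`, but each time it is the value of the same
  -- call of `lightest`. Hence a single set beats all competitors.
  same : ∀ Y ntY → proj₁ (best Y ntY) ≡ proj₁ (best X nt)
  same Y ntY = just-injective (trans (sym (proj₁ (proj₂ (best Y ntY)))) (proj₁ (proj₂ (best X nt))))

-- Picking the endpoint of an unknown edge.

infixr 6 _∩_
_∩_ : (X Y : Fin n → Bool) → Fin n → Bool
(X ∩ Y) u = X u ∧ Y u

locate-cong : ∀ {P Q : ℕ → ℕ} → (∀ t → P t ≡ Q t) → ∀ m lo i → locate P m lo i ≡ locate Q m lo i
locate-cong e zero    lo i = refl
locate-cong {P} {Q} e (suc m) lo i rewrite e (lo + 2 ^ m) with i <ᵇ Q (lo + 2 ^ m)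
... | true  = locate-cong e m lo i
... | false = locate-cong e m (lo + 2 ^ m) i

residual : Matrix n → Matrix n → Matrix n
residual M H u v = M u v ∸ H u v

module _ (d : Fin n) (L : ℕ) (H : Matrix n) (A B : Fin n → Bool) (i : ℕ) where

  -- Known edges are subtracted without a query, which leaves the number of unknown edges from an
  -- initial segment of `A` to `B`. The search on these numbers finds the end in `A` of the edge
  -- with index `i`.
  askPrefix : ℕ → Routine n ℕ
  askPrefix t k = askBetween (A ∩ below t) B λ x → k (x ∸ form H (χ (A ∩ below t)) (χ B))

  pickVertex : Routine n (Fin n)
  pickVertex k = search askPrefix L 0 i (k ∘ clamp d)

  module _ (G : Graph n) where

    pickedPrefix : ℕ → ℕ
    pickedPrefix t = between G (A ∩ below t) B ∸ form H (χ (A ∩ below t)) (χ B)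

    picked : Fin n
    picked = clamp d (locate pickedPrefix L 0 i)

    pickVertex-computes : Computes G pickVertex (L * 3) picked
    pickVertex-computes = subst (λ t → Computes G pickVertex t picked) (+-identityʳ (L * 3))
      (computes-bind (search askPrefix L 0 i) (λ x k → k (clamp d x)) (search-computes ask L 0 i) computes-return)
      where
      ask : ∀ t → Computes G (askPrefix t) 3 (pickedPrefix t)
      ask t = computes-bind (askBetween (A ∩ below t) B) (λ x k → k (x ∸ form H (χ (A ∩ below t)) (χ B)))
                (askBetween-computes (A ∩ below t) B) computes-return

    weight : Fin n → ℕ
    weight u = χ A u * sum λ v → residual (edges G) H u v * χ B v

    sum-weight : sum weight ≡ form (residual (edges G) H) (χ A) (χ B)
    sum-weight = sym form-rows

    -- Since `H ≤ edges G`, truncated subtraction is exact and the form is linear in the residual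
    -- edges. The answers are thus the prefix sums of `weight`.
    picked≡pick : (∀ u v → H u v ≤ edges G u v) → Disjoint A B → picked ≡ pick d L weight i
    picked≡pick H≤ dis = cong (clamp d) (locate-cong P≡ L 0 i)
      where
      open ≡-Reasoning
      dis′ : ∀ t → Disjoint (A ∩ below t) B
      dis′ t u with A u in a | dis u
      ... | false | _ = refl
      ... | true  | e = trans (cong (below t u ∧_) e) (Bool.∧-zeroʳ (below t u))
      P≡ : ∀ t → pickedPrefix t ≡ prefix weight t
      P≡ t = begin
        between G A′ B ∸ form H (χ A′) (χ B)
          ≡⟨ cong (_∸ form H (χ A′) (χ B)) (between≡form G (dis′ t)) ⟩
        form (edges G) (χ A′) (χ B) ∸ form H (χ A′) (χ B)
          ≡⟨ cong (_∸ form H (χ A′) (χ B)) (trans (form-cong (λ u v → sym (m∸n+n≡m (H≤ u v))) (λ _ → refl) (λ _ → refl)) form-+) ⟩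
        form (residual (edges G) H) (χ A′) (χ B) + form H (χ A′) (χ B) ∸ form H (χ A′) (χ B)
          ≡⟨ m+n∸n≡m _ (form H (χ A′) (χ B)) ⟩
        form (residual (edges G) H) (χ A′) (χ B)
          ≡⟨ form-rows ⟩
        sum (λ u → χ A′ u * sum λ v → residual (edges G) H u v * χ B v)
          ≡⟨ (sum-cong-≗ λ u → trans (cong (_* row u) (trans (⟦∧⟧ (A u) (below t u)) (*-comm (χ A u) ⟦ below t u ⟧))) (*-assoc ⟦ below t u ⟧ (χ A u) (row u))) ⟩
        sum (λ u → ⟦ below t u ⟧ * weight u)
          ≡⟨ prefix-def ⟨
        prefix weight t ∎
        where
        A′ = A ∩ below t
        row : Fin n → ℕ
        row u = sum λ v → residual (edges G) H u v * χ B v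

χ-true : ∀ {X : Fin n → Bool} {u} → 0 < χ X u → X u ≡ true
χ-true {X = X} {u} p with X u
... | true = refl

-- Minimum cut from a sparse certificate

addEdge : Fin n → Fin n → Matrix n → Matrix n
addEdge u v H x y = H x y + (⟦ u == x ⟧ * ⟦ v == y ⟧ + ⟦ v == x ⟧ * ⟦ u == y ⟧)

form-addEdge : ∀ (u v : Fin n) H f g → form (addEdge u v H) f g ≡ form H f g + (f u * g v + f v * g u)
form-addEdge {n} u v H f g = trans form-+ (cong (form H f g +_) (trans form-+ (cong₂ _+_ (single u v) (single v u))))
  where
  open ≡-Reasoning
  reorder : ∀ a b c d → a * ((b * c) * d) ≡ b * (a * (c * d))
  reorder = solve-∀
  single : ∀ u v → form (λ x y → ⟦ u == x ⟧ * ⟦ v == y ⟧) f g ≡ f u * g v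
  single u v = begin
    form (λ x y → ⟦ u == x ⟧ * ⟦ v == y ⟧) f g
      ≡⟨ form-def ⟩
    sum (λ x → sum λ y → f x * ((⟦ u == x ⟧ * ⟦ v == y ⟧) * g y))
      ≡⟨ (sum-cong-≗ λ x → trans (sum-cong-≗ λ y → reorder (f x) ⟦ u == x ⟧ ⟦ v == y ⟧ (g y))
           (trans (sym (*-distribˡ-sum ⟦ u == x ⟧ (λ y → f x * (⟦ v == y ⟧ * g y))))
             (cong (⟦ u == x ⟧ *_) (trans (sym (*-distribˡ-sum (f x) (λ y → ⟦ v == y ⟧ * g y))) (cong (f x *_) (sum-δ v g)))))) ⟩
    sum (λ x → ⟦ u == x ⟧ * (f x * g v))
      ≡⟨ sum-δ u (λ x → f x * g v) ⟩
    f u * g v ∎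

addEdge-sym : ∀ {u v : Fin n} {H} → Symmetric H → Symmetric (addEdge u v H)
addEdge-sym {u = u} {v} s x y = cong₂ _+_ (s x y) (e ⟦ u == x ⟧ ⟦ v == y ⟧ ⟦ v == x ⟧ ⟦ u == y ⟧)
  where
  e : ∀ a b c d → a * b + c * d ≡ d * c + b * a
  e = solve-∀

-- As `u ≢ v`, the two orientations are distinct entries. Each grows by one only, and the strict
-- inequality, carried over by symmetry, leaves room in both.
addEdge-≤ : ∀ {u v : Fin n} {H M : Matrix n} → Symmetric H → Symmetric M → u ≢ v → (∀ x y → H x y ≤ M x y) →
            H u v < M u v → ∀ x y → addEdge u v H x y ≤ M x y
addEdge-≤ {u = u} {v} {H} {M} sH sM u≢v H≤ lt x y = go (u == x) refl (v == y) refl (v == x) refl (u == y) refl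
  where
  go : ∀ a → (u == x) ≡ a → ∀ b → (v == y) ≡ b → ∀ c → (v == x) ≡ c → ∀ d → (u == y) ≡ d → H x y + (⟦ a ⟧ * ⟦ b ⟧ + ⟦ c ⟧ * ⟦ d ⟧) ≤ M x y
  go true ux b vy true vx d uy = contradiction (trans (==⇒≡ ux) (sym (==⇒≡ vx))) u≢v
  go a ux true vy c vx true uy = contradiction (trans (==⇒≡ uy) (sym (==⇒≡ vy))) u≢v
  go true ux true vy false vx false uy =
    subst₂ (λ x y → H x y + 1 ≤ M x y) (==⇒≡ {u = u} ux) (==⇒≡ {u = v} vy) (subst (_≤ M u v) (+-comm 1 (H u v)) lt)
  go false ux false vy true vx true uy =
    subst₂ (λ x y → H x y + 1 ≤ M x y) (==⇒≡ {u = v} vx) (==⇒≡ {u = u} uy) (subst (_≤ M v u) (+-comm 1 (H v u)) (subst₂ _<_ (sH u v) (sM u v) lt))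
  go false ux b vy false vx d uy = subst (_≤ M x y) (sym (+-identityʳ (H x y))) (H≤ x y)
  go true ux false vy false vx d uy = subst (_≤ M x y) (sym (+-identityʳ (H x y))) (H≤ x y)
  go false ux b vy true vx false uy = subst (_≤ M x y) (sym (+-identityʳ (H x y))) (H≤ x y)

module _ (lab : Fin n → Fin N) (δ : ℕ) where

  size : (Fin N → Bool) → ℕ
  size W = sum (χ W)

  lift : (Fin N → Bool) → Fin n → Bool
  lift W u = W (lab u)

  -- Every set of w ≥ 1 classes spans at most δ (w − 1) edges of H; form counts each edge twice.
  Sparse : Matrix n → Set
  Sparse H = ∀ W {ℓ} → W ℓ ≡ true → form H (χ (lift W)) (χ (lift W)) + 2 * δ ≤ 2 * δ * size W

  size-positive : ∀ W {ℓ} → W ℓ ≡ true → 1 ≤ size W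
  size-positive W {ℓ} e = ≤-trans (≤-reflexive (cong ⟦_⟧ (sym e))) (term≤sum (χ W) ℓ)

  sparse-empty : Sparse (λ _ _ → 0)
  sparse-empty W {ℓ} e = begin
    form (λ _ _ → 0) (χ (lift W)) (χ (lift W)) + 2 * δ  ≡⟨ cong (_+ 2 * δ) (trans form-def (sum-zero λ u → sum-zero {n} {λ v → χ (lift W) u * (0 * χ (lift W) v)} λ v → *-zeroʳ (χ (lift W) u))) ⟩
    2 * δ                                               ≡⟨ *-identityʳ (2 * δ) ⟨
    2 * δ * 1                                           ≤⟨ *-monoʳ-≤ (2 * δ) (size-positive W e) ⟩
    2 * δ * size W                                      ∎
    where open ≤-Reasoning

  -- The light cut `T` splits `W` in two. If one part is empty, the new edge is not inside `W`.
  -- Otherwise the parts span at most `δ (w₁ - 1)` and `δ (w₂ - 1)` edges, and at most `δ` edges run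
  -- between them, the new one included; together these are at most `δ (w - 1)`. For `δ = 1` this is
  -- the edge count of a forest.
  sparse-addEdge : ∀ {H} T {u v} → Symmetric H → Sparse H → cutVal H (lift T) < δ → lift T u ≡ true → lift T v ≡ false →
                   Sparse (addEdge u v H)
  sparse-addEdge {H} T {u} {v} sH sparse light Tu Tv W {ℓ} Wℓ = cases (Fin.any? λ ℓ → W₁ ℓ Bool.≟ true) (Fin.any? λ ℓ → W₂ ℓ Bool.≟ true)
    where
    open ≤-Reasoning
    W₁ W₂ : Fin N → Bool
    W₁ = W ∩ T
    W₂ = W ∩ ∁ T
    H′ = addEdge u v H
    unchanged : ∀ V → χ (lift V) u * χ (lift V) v ≡ 0 → form H′ (χ (lift V)) (χ (lift V)) ≡ form H (χ (lift V)) (χ (lift V))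
    unchanged V e = trans (form-addEdge u v H _ _) (trans (cong (form H (χ (lift V)) (χ (lift V)) +_) (cong₂ _+_ e (trans (*-comm (χ (lift V) v) _) e))) (+-identityʳ _))
    in-both : ∀ a b → (a ≡ true → b ≡ true → ⊥) → ⟦ a ⟧ * ⟦ b ⟧ ≡ 0
    in-both true true f = ⊥-elim (f refl refl)
    in-both true false f = refl
    in-both false b f = refl
    T-clash : lift T u ≡ false → ⊥
    T-clash e with () ← trans (sym Tu) e
    T-clash′ : lift T v ≡ true → ⊥
    T-clash′ e with () ← trans (sym Tv) e
    split : ∀ w t → ⟦ w ⟧ ≡ ⟦ w ∧ t ⟧ + ⟦ w ∧ not t ⟧
    split false t = refl
    split true true = refl
    split true false = refl
    cross : form H′ (χ (lift W₁)) (χ (lift W₂)) ≤ δ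
    cross = begin
      form H′ (χ (lift W₁)) (χ (lift W₂))        ≤⟨ form-mono (λ _ _ → ≤-refl) (λ x → ∧-≤ (W (lab x)) (T (lab x))) (λ x → ∧-≤ (W (lab x)) (not (T (lab x)))) ⟩
      cutVal H′ (lift T)                         ≡⟨ form-addEdge u v H _ _ ⟩
      cutVal H (lift T) + (χ (lift T) u * χ (∁ (lift T)) v + χ (lift T) v * χ (∁ (lift T)) u)
                                                 ≡⟨ cong (cutVal H (lift T) +_) (cong₂ (λ a b → ⟦ a ⟧ * ⟦ not b ⟧ + ⟦ b ⟧ * ⟦ not a ⟧) Tu Tv) ⟩
      cutVal H (lift T) + 1                      ≡⟨ +-comm _ 1 ⟩
      1 + cutVal H (lift T)                      ≤⟨ light ⟩
      δ                                          ∎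
      where
      ∧-≤ : ∀ a b → ⟦ a ∧ b ⟧ ≤ ⟦ b ⟧
      ∧-≤ true  b = ≤-refl
      ∧-≤ false b = z≤n
    reassoc : ∀ a b c d → a + c + (c + b) + d ≡ (a + b) + (c + c) + d
    reassoc = solve-∀
    pair : ∀ δ s t → 2 * δ * s + 2 * δ * t ≡ 2 * δ * (s + t)
    pair = solve-∀
    shuffle : ∀ a b c d → (a + b) + (c + c) + 2 * d ≡ (a + 2 * c) + (b + 2 * d)
    shuffle = solve-∀
    cases : Dec (∃ λ ℓ → W₁ ℓ ≡ true) → Dec (∃ λ ℓ → W₂ ℓ ≡ true) → form H′ (χ (lift W)) (χ (lift W)) + 2 * δ ≤ 2 * δ * size W
    cases (no ¬1) _ = subst (λ x → x + 2 * δ ≤ 2 * δ * size W)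
      (sym (unchanged W (in-both (lift W u) (lift W v) λ Wu _ → ¬1 (lab u , cong₂ _∧_ Wu Tu)))) (sparse W Wℓ)
    cases _ (no ¬2) = subst (λ x → x + 2 * δ ≤ 2 * δ * size W)
      (sym (unchanged W (in-both (lift W u) (lift W v) λ _ Wv → ¬2 (lab v , cong₂ _∧_ Wv (cong not Tv))))) (sparse W Wℓ)
    cases (yes (ℓ₁ , e₁)) (yes (ℓ₂ , e₂)) = begin
      form H′ (χ (lift W)) (χ (lift W)) + 2 * δ
        ≡⟨ cong (_+ 2 * δ) (trans (form-cong (λ _ _ → refl) (λ x → split (W (lab x)) (T (lab x))) (λ x → split (W (lab x)) (T (lab x))))
             (trans form-+ˡ (cong₂ _+_ form-+ʳ (trans form-+ʳ (cong (_+ form H′ c₂ c₂) (form-swap (addEdge-sym {u = u} {v} {H} sH))))))) ⟩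
      form H′ c₁ c₁ + form H′ c₁ c₂ + (form H′ c₁ c₂ + form H′ c₂ c₂) + 2 * δ
        ≡⟨ reassoc (form H′ c₁ c₁) _ (form H′ c₁ c₂) (2 * δ) ⟩
      (form H′ c₁ c₁ + form H′ c₂ c₂) + (form H′ c₁ c₂ + form H′ c₁ c₂) + 2 * δ
        ≤⟨ +-monoˡ-≤ (2 * δ) (+-mono-≤ (≤-reflexive (cong₂ _+_
             (unchanged W₁ (in-both (lift W₁ u) (lift W₁ v) λ _ e → T-clash′ (proj₂ (∧-true e))))
             (unchanged W₂ (in-both (lift W₂ u) (lift W₂ v) λ e _ → T-clash (not-true⇒false (proj₂ (∧-true e)))))))
             (+-mono-≤ cross cross)) ⟩
      (form H c₁ c₁ + form H c₂ c₂) + (δ + δ) + 2 * δ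
        ≡⟨ shuffle (form H c₁ c₁) (form H c₂ c₂) δ δ ⟩
      (form H c₁ c₁ + 2 * δ) + (form H c₂ c₂ + 2 * δ)
        ≤⟨ +-mono-≤ (sparse W₁ e₁) (sparse W₂ e₂) ⟩
      2 * δ * size W₁ + 2 * δ * size W₂
        ≡⟨ pair δ (size W₁) (size W₂) ⟩
      2 * δ * (size W₁ + size W₂)
        ≡⟨ cong (2 * δ *_) (trans (sym (∑-distrib-+ (χ W₁) (χ W₂))) (sum-cong-≗ λ ℓ → sym (split (W ℓ) (T ℓ)))) ⟩
      2 * δ * size W ∎
      where
      c₁ c₂ : Fin n → ℕ
      c₁ = χ (lift W₁)
      c₂ = χ (lift W₂)

module Recover (d : Fin n) (L : ℕ) (lab : Fin n → Fin N) where

  knownCut : Matrix n → Subset N → ℕ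
  knownCut H S = cutVal H (lookup S ∘ lab)

  candidate : Matrix n → Maybe (Subset N)
  candidate H = lightest nontrivialᵇ (knownCut H) (allSubsets N)

  -- A trivial set, which `amplify` discards.
  giveUp : Subset n
  giveUp = tabulate λ _ → true

  -- H holds the known edges; the ℕ is fuel.
  recover : ℕ → Matrix n → Routine n (Subset n)
  extend  : ℕ → Matrix n → Maybe (Subset N) → Routine n (Subset n)
  recover zero    H = λ k → k giveUp
  recover (suc f) H = extend f H (candidate H)
  extend f H nothing  = λ k → k giveUp
  extend f H (just S) = λ k → askCut X λ c → (if c ≤ᵇ cutVal H X then (λ k → k (tabulate X)) else
      -- Any unknown edge across `X` will do, so the index is 0 and no coin is flipped. The first
      -- search finds its end `u` in `X`, the second an end `v` among the vertices outside.
      (λ k → pickVertex d L H X (∁ X) 0 λ u → pickVertex d L H (∁ X) (u ==_) 0 λ v → recover f (addEdge u v H) k)) k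
    where
    X : Fin n → Bool
    X = lookup S ∘ lab

  recoverCost : ℕ → ℕ
  recoverCost f = f * (1 + (L * 3 + L * 3))

  module _ (G : Graph n) (n≤2^L : n ≤ 2 ^ L) where

    -- The invariant refers to a minimum cut `Y` that the algorithm does not know. In `enough-fuel`,
    -- each learned edge raises the form by 2 and uses one unit of fuel, so the right-hand side
    -- stays constant.
    record Partial (δ : ℕ) (Y : Fin N → Bool) (H : Matrix n) (f : ℕ) : Set where
      field
        surjective   : ∀ ℓ → ∃ λ u → lab u ≡ ℓ
        minimum      : IsMinCut G (Y ∘ lab)
        light        : cutVal (edges G) (Y ∘ lab) < δ
        known-sym    : Symmetric H
        known-≤      : ∀ u v → H u v ≤ edges G u v
        known-sparse : Sparse lab δ H
        enough-fuel  : 2 * δ * N ≤ form H (λ _ → 1) (λ _ → 1) + 2 * f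
    open Partial

    Y-nontrivial : ∀ {δ Y H f} → Partial δ Y H f → Nontrivial Y
    Y-nontrivial P with minimum P
    ... | ((u , p) , (v , q)) , _ = (lab u , p) , (lab v , q)

    -- Sparsity of the set of all classes keeps the form at least `2 * δ` below `2 * δ * N`, and
    -- `light` makes `δ` positive.
    out-of-fuel : ∀ {δ Y H} → ¬ Partial δ Y H 0
    out-of-fuel {δ} {Y} {H} P = <-irrefl refl (<-≤-trans (begin-strict
      2 * δ * N             ≤⟨ enough-fuel P ⟩
      all + 0               ≡⟨ +-identityʳ all ⟩
      all                   <⟨ m<m+n all (<-≤-trans (≤-<-trans z≤n (light P)) (m≤m+n δ _)) ⟩
      all + 2 * δ           ∎) (begin
      all + 2 * δ           ≤⟨ known-sparse P (λ _ → true) {proj₁ (proj₁ (Y-nontrivial P))} refl ⟩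
      2 * δ * sum {N} (λ _ → 1) ≡⟨ cong (2 * δ *_) (trans (sum-const N 1) (*-identityʳ N)) ⟩
      2 * δ * N             ∎))
      where
      open ≤-Reasoning
      all = form H (λ _ → 1) (λ _ → 1)

    -- `Y` is among the competitors, and known edges are true edges. The bound is used twice: it
    -- certifies the candidate when no edge is missing, and it keeps the known cut below `δ`, as
    -- sparsity requires, when one is added.
    candidate-light : ∀ {δ Y H f} → Partial δ Y H f →
                      ∃ λ S → candidate H ≡ just S × Nontrivial (lookup S) × knownCut H S ≤ cutVal (edges G) (Y ∘ lab)
    candidate-light {Y = Y} {H} P with lightest-min nontrivialᵇ (knownCut H) (∈-allSubsets (tabulate Y))
      (nontrivialᵇ-intro (tabulate Y) (nontrivial-cong (λ ℓ → sym (lookup∘tabulate Y ℓ)) (Y-nontrivial P)))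
    ... | S , e , le = S , e , nontrivialᵇ-elim S (lightest-sat nontrivialᵇ (knownCut H) (allSubsets N) e) , (begin
      knownCut H S                  ≤⟨ le ⟩
      knownCut H (tabulate Y)       ≡⟨ cutVal-cong H (λ u → lookup∘tabulate Y (lab u)) ⟩
      cutVal H (Y ∘ lab)            ≤⟨ form-mono (known-≤ P) (λ _ → ≤-refl) (λ _ → ≤-refl) ⟩
      cutVal (edges G) (Y ∘ lab)    ∎)
      where open ≤-Reasoning

    module _ {δ Y H f} (P : Partial δ Y H (suc f)) (S : Subset N) (nt : Nontrivial (lookup S))
             (le : knownCut H S ≤ cutVal (edges G) (Y ∘ lab)) where

      private
        X : Fin n → Bool
        X = lookup S ∘ lab

        ρ : Matrix n
        ρ = residual (edges G) H

        ρ-sym : Symmetric ρ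
        ρ-sym x y = cong₂ _∸_ (edges-sym G x y) (known-sym P x y)

      resolved : cutVal (edges G) X ≤ cutVal H X → IsMinCut G (lookup (tabulate X))
      resolved le′ = nontrivial-cong (λ u → sym (lookup∘tabulate X u)) X-nontrivial , λ Z ntZ → begin
        cutVal (edges G) (lookup (tabulate X))  ≡⟨ cutVal-cong (edges G) (lookup∘tabulate X) ⟩
        cutVal (edges G) X                      ≤⟨ le′ ⟩
        cutVal H X                              ≤⟨ le ⟩
        cutVal (edges G) (Y ∘ lab)              ≤⟨ proj₂ (minimum P) Z ntZ ⟩
        cutVal (edges G) Z                      ∎
        where
        open ≤-Reasoning
        side : ∀ {b} → (∃ λ ℓ → lookup S ℓ ≡ b) → ∃ λ u → X u ≡ b
        side (ℓ , p) with surjective P ℓ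
        ... | u , refl = u , p
        X-nontrivial : Nontrivial X
        X-nontrivial = side (proj₁ nt) , side (proj₂ nt)

      module _ (lt : cutVal H X < cutVal (edges G) X) where

        private
          u : Fin n
          u = picked d L H X (∁ X) 0 G

          v : Fin n
          v = picked d L H (∁ X) (u ==_) 0 G

          X-disjoint : Disjoint X (∁ X)
          X-disjoint x with X x
          ... | true  = refl
          ... | false = refl

          row-positive : 0 < weight d L H X (∁ X) 0 G u
          row-positive = subst (λ u → 0 < weight d L H X (∁ X) 0 G u) (sym (picked≡pick d L H X (∁ X) 0 G (known-≤ P) X-disjoint))
            (pick-positive d L (weight d L H X (∁ X) 0 G) n≤2^L (subst (0 <_) (sym (sum-weight d L H X (∁ X) 0 G)) ρ-positive))
            where
            ρ-positive : 0 < cutVal ρ X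
            ρ-positive = +-cancelʳ-< (cutVal H X) 0 (cutVal ρ X) (<-≤-trans lt (≤-reflexive
              (trans (form-cong (λ x y → sym (m∸n+n≡m (known-≤ P x y))) (λ _ → refl) (λ _ → refl)) form-+)))

          Xu : X u ≡ true
          Xu = χ-true {X = X} {u} (0<m*n⇒0<m row-positive)

          entry-positive : 0 < weight d L H (∁ X) (u ==_) 0 G v
          entry-positive = subst (λ v → 0 < weight d L H (∁ X) (u ==_) 0 G v) (sym (picked≡pick d L H (∁ X) (u ==_) 0 G (known-≤ P) dis))
            (pick-positive d L (weight d L H (∁ X) (u ==_) 0 G) n≤2^L (subst (0 <_) (sym e) row-positive))
            where
            open ≡-Reasoning
            dis : Disjoint (∁ X) (u ==_)
            dis x with u Fin.≟ x
            ... | yes refl = trans (Bool.∧-identityʳ (∁ X u)) (cong not Xu)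
            ... | no _     = Bool.∧-zeroʳ (∁ X x)
            e : sum (weight d L H (∁ X) (u ==_) 0 G) ≡ weight d L H X (∁ X) 0 G u
            e = begin
              sum (weight d L H (∁ X) (u ==_) 0 G)                    ≡⟨ sum-weight d L H (∁ X) (u ==_) 0 G ⟩
              form ρ (χ (∁ X)) (χ (u ==_))                            ≡⟨ form-swap ρ-sym ⟩
              form ρ (χ (u ==_)) (χ (∁ X))                            ≡⟨ form-rows ⟩
              sum (λ x → χ (u ==_) x * sum λ y → ρ x y * χ (∁ X) y)   ≡⟨ sum-δ u (λ x → sum λ y → ρ x y * χ (∁ X) y) ⟩
              sum (λ y → ρ u y * χ (∁ X) y)                           ≡⟨ +-identityʳ _ ⟨
              1 * sum (λ y → ρ u y * χ (∁ X) y)                       ≡⟨ cong (λ b → ⟦ b ⟧ * sum (λ y → ρ u y * χ (∁ X) y)) Xu ⟨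
              weight d L H X (∁ X) 0 G u                              ∎

          Xv : X v ≡ false
          Xv = not-true⇒false (χ-true {X = ∁ X} {v} (0<m*n⇒0<m entry-positive))

          u≢v : u ≢ v
          u≢v e = contradiction (trans (sym Xu) (trans (cong X e) Xv)) λ ()

          unknown : H u v < edges G u v
          unknown = subst₂ _<_ (known-sym P v u) (edges-sym G v u) (m<n∸o⇒ (subst (0 <_) ρvu (0<m*n⇒0<n (χ (∁ X) v) entry-positive)))
            where
            m<n∸o⇒ : ∀ {m n} → 0 < n ∸ m → m < n
            m<n∸o⇒ {zero}  {suc n} p = s≤s z≤n
            m<n∸o⇒ {suc m} {suc n} p = s≤s (m<n∸o⇒ p)
            ρvu : sum (λ y → ρ v y * χ (u ==_) y) ≡ ρ v u
            ρvu = trans (sum-cong-≗ λ y → *-comm (ρ v y) (χ (u ==_) y)) (sum-δ u (ρ v))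

        advance : Partial δ Y (addEdge u v H) f
        advance = record
          { surjective   = surjective P
          ; minimum      = minimum P
          ; light        = light P
          ; known-sym    = addEdge-sym {u = u} {v} {H} (known-sym P)
          ; known-≤      = addEdge-≤ (known-sym P) (edges-sym G) u≢v (known-≤ P) unknown
          ; known-sparse = sparse-addEdge lab δ (lookup S) (known-sym P) (known-sparse P) (≤-<-trans le (light P)) Xu Xv
          ; enough-fuel  = ≤-trans (enough-fuel P) (≤-reflexive (trans (e (form H (λ _ → 1) (λ _ → 1)) f)
                             (cong (_+ 2 * f) (sym (form-addEdge u v H (λ _ → 1) (λ _ → 1)))))) }
          where
          e : ∀ a f → a + 2 * suc f ≡ a + 2 + 2 * f
          e = solve-∀

    -- Contraction may already have destroyed the cut. The result and the cost are therefore
    -- asserted for every labelling, and the invariant enters only in the correctness.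
    recover-computes : ∀ f H → ∃ λ S → Computes G (recover f H) (recoverCost f) S ×
                       (∀ {δ Y} → Partial δ Y H f → IsMinCut G (lookup S))
    recover-computes zero    H = giveUp , computes-return , λ P → contradiction P out-of-fuel
    recover-computes (suc f) H with candidate H in eq
    ... | nothing = giveUp , computes-weaken z≤n computes-return , λ P → contradiction (trans (sym eq) (proj₁ (proj₂ (candidate-light P)))) λ ()
    ... | just S = branch (cutVal (edges G) X ≤ᵇ cutVal H X) refl
      where
      X : Fin n → Bool
      X = lookup S ∘ lab
      u v : Fin n
      u = picked d L H X (∁ X) 0 G
      v = picked d L H (∁ X) (u ==_) 0 G
      next : Bool → Routine n (Subset n)
      next b = if b then (λ k → k (tabulate X)) else
        (λ k → pickVertex d L H X (∁ X) 0 λ u → pickVertex d L H (∁ X) (u ==_) 0 λ v → recover f (addEdge u v H) k)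
      from : ∀ {δ Y} → Partial δ Y H (suc f) → Nontrivial (lookup S) × knownCut H S ≤ cutVal (edges G) (Y ∘ lab)
      from P with candidate-light P
      ... | S′ , e , nt , le with refl ← trans (sym eq) e = nt , le
      branch : ∀ b → (cutVal (edges G) X ≤ᵇ cutVal H X) ≡ b → ∃ λ S′ → Computes G (extend f H (just S)) (recoverCost (suc f)) S′ ×
               (∀ {δ Y} → Partial δ Y H (suc f) → IsMinCut G (lookup S′))
      branch true e = tabulate X ,
        computes-weaken (s≤s z≤n) (computes-bind (askCut X) (λ c → next (c ≤ᵇ cutVal H X)) (askCut-computes X)
          (subst (λ b → Computes G (next b) 0 (tabulate X)) (sym e) computes-return)) ,
        λ P → resolved P S (proj₁ (from P)) (proj₂ (from P)) (≤ᵇ⇒≤ _ _ (subst T (sym e) _))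
      branch false e with recover-computes f (addEdge u v H)
      ... | S′ , computes , correct = S′ ,
        computes-weaken (≤-reflexive (arith L (recoverCost f))) (computes-bind (askCut X) (λ c → next (c ≤ᵇ cutVal H X)) (askCut-computes X)
          (subst (λ b → Computes G (next b) (L * 3 + (L * 3 + recoverCost f)) S′) (sym e)
            (computes-bind (pickVertex d L H X (∁ X) 0) (λ u k → pickVertex d L H (∁ X) (u ==_) 0 λ v → recover f (addEdge u v H) k)
              (pickVertex-computes d L H X (∁ X) 0 G)
              (computes-bind (pickVertex d L H (∁ X) (u ==_) 0) (λ v → recover f (addEdge u v H))
                (pickVertex-computes d L H (∁ X) (u ==_) 0 G) computes)))) ,
        λ P → correct (advance P S (proj₁ (from P)) (proj₂ (from P)) (≰⇒> λ le → subst T e (≤⇒≤ᵇ le)))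
        where
        arith : ∀ L r → 1 + (L * 3 + (L * 3 + r)) ≡ (1 + (L * 3 + L * 3)) + r
        arith = solve-∀

-- Random contraction

n<2^n : ∀ n → n < 2 ^ n
n<2^n zero    = s≤s z≤n
n<2^n (suc n) = subst (suc (suc n) ≤_) (cong (2 ^ n +_) (sym (+-identityʳ (2 ^ n)))) (+-mono-≤ (≤-trans (s≤s z≤n) (n<2^n n)) (n<2^n n))

2^⌊log₂n⌋≤n : ∀ n → 1 ≤ n → 2 ^ ⌊log₂ n ⌋ ≤ n
2^⌊log₂n⌋≤n = <-rec _ go
  where
  open ≤-Reasoning
  go : ∀ n → (∀ {m} → m < n → 1 ≤ m → 2 ^ ⌊log₂ m ⌋ ≤ m) → 1 ≤ n → 2 ^ ⌊log₂ n ⌋ ≤ n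
  go (suc zero)    rec _ = ≤-refl
  go n@(suc (suc m)) rec _ = begin
    2 ^ ⌊log₂ n ⌋                  ≡⟨ cong (2 ^_) (m+[n∸m]≡n {1} {⌊log₂ n ⌋} (⌊log₂⌋-mono-≤ {2} {n} (s≤s (s≤s z≤n)))) ⟨
    2 * 2 ^ (⌊log₂ n ⌋ ∸ 1)        ≡⟨ cong (λ e → 2 * 2 ^ e) (⌊log₂⌊n/2⌋⌋≡⌊log₂n⌋∸1 n) ⟨
    2 * 2 ^ ⌊log₂ ⌊ n /2⌋ ⌋        ≤⟨ *-monoʳ-≤ 2 (rec {⌊ n /2⌋} (⌊n/2⌋<n (suc m)) (s≤s z≤n)) ⟩
    2 * ⌊ n /2⌋                    ≡⟨ cong (⌊ n /2⌋ +_) (+-identityʳ ⌊ n /2⌋) ⟩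
    ⌊ n /2⌋ + ⌊ n /2⌋              ≤⟨ +-monoʳ-≤ ⌊ n /2⌋ (⌊n/2⌋≤⌈n/2⌉ n) ⟩
    ⌊ n /2⌋ + ⌈ n /2⌉              ≡⟨ ⌊n/2⌋+⌈n/2⌉≡n n ⟩
    n                              ∎

n≤2^⌈log₂n⌉ : ∀ n → n ≤ 2 ^ ⌈log₂ n ⌉
n≤2^⌈log₂n⌉ = <-rec _ go
  where
  open ≤-Reasoning
  go : ∀ n → (∀ {m} → m < n → m ≤ 2 ^ ⌈log₂ m ⌉) → n ≤ 2 ^ ⌈log₂ n ⌉
  go zero       rec = z≤n
  go (suc zero) rec = ≤-refl
  go n@(suc (suc m)) rec = begin
    n                              ≡⟨ ⌊n/2⌋+⌈n/2⌉≡n n ⟨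
    ⌊ n /2⌋ + ⌈ n /2⌉              ≤⟨ +-monoˡ-≤ ⌈ n /2⌉ (⌊n/2⌋≤⌈n/2⌉ n) ⟩
    ⌈ n /2⌉ + ⌈ n /2⌉              ≡⟨ cong (⌈ n /2⌉ +_) (+-identityʳ ⌈ n /2⌉) ⟨
    2 * ⌈ n /2⌉                    ≤⟨ *-monoʳ-≤ 2 (rec {⌈ n /2⌉} (⌈n/2⌉<n m)) ⟩
    2 * 2 ^ ⌈log₂ ⌈ n /2⌉ ⌉        ≡⟨ cong (λ e → 2 * 2 ^ e) (⌈log₂⌈n/2⌉⌉≡⌈log₂n⌉∸1 n) ⟩
    2 * 2 ^ (⌈log₂ n ⌉ ∸ 1)        ≡⟨ cong (2 ^_) (m+[n∸m]≡n {1} {⌈log₂ n ⌉} (⌈log₂⌉-mono-≤ {2} {n} (s≤s (s≤s z≤n)))) ⟩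
    2 ^ ⌈log₂ n ⌉                  ∎

bernoulli : ∀ k B Δ → B ^ suc k + suc k * Δ * B ^ k ≤ (B + Δ) ^ suc k
bernoulli zero    B Δ = ≤-reflexive (e B Δ)
  where
  e : ∀ B Δ → B * 1 + (Δ + 0) * 1 ≡ (B + Δ) * 1
  e = solve-∀
bernoulli (suc k) B Δ = begin
  B * (B * B ^ k) + (Δ + suc k * Δ) * (B * B ^ k)
    ≤⟨ m≤m+n _ _ ⟩
  B * (B * B ^ k) + (Δ + suc k * Δ) * (B * B ^ k) + Δ * (suc k * Δ * B ^ k)
    ≡⟨ e B Δ (suc k * Δ) (B ^ k) ⟩
  (B + Δ) * (B * B ^ k + suc k * Δ * B ^ k)
    ≤⟨ *-monoʳ-≤ (B + Δ) (bernoulli k B Δ) ⟩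
  (B + Δ) * (B + Δ) ^ suc k ∎
  where
  open ≤-Reasoning
  e : ∀ B Δ q p → B * (B * p) + (Δ + q) * (B * p) + Δ * (q * p) ≡ (B + Δ) * (B * p + q * p)
  e = solve-∀

-- One contraction step costs a factor good / M of success probability,
-- which is paid for by raising the budget from B to B + c ρ.  The constant: bad B ≤ 20 M c ρ and good ≥ 3 M / 8
-- give bad B ≤ good (160 / 3) c ρ.
module _ {M d c bad good B U δ s ρ k : ℕ} .{{_ : NonZero d}} (k-large : 54 ≤ suc k)
         (total : good + bad ≡ M) (counted : d * bad ≤ (M + d) * c) (fine : 4 * d ≤ M) (half : 2 * c ≤ d)
         (B≤ : B ≤ 4 * (U * δ)) (dense : s * δ ≤ 2 * d) (U≤ : U ≤ 2 * ρ * s) where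

  open ≤-Reasoning

  private
    bad-bound : 4 * (d * bad) ≤ 5 * (M * c)
    bad-bound = begin
      4 * (d * bad)            ≤⟨ *-monoʳ-≤ 4 counted ⟩
      4 * ((M + d) * c)        ≡⟨ e M d c ⟩
      (4 * M + 4 * d) * c      ≤⟨ *-monoˡ-≤ c (+-monoʳ-≤ (4 * M) fine) ⟩
      (4 * M + M) * c          ≡⟨ e′ M c ⟩
      5 * (M * c)              ∎
      where
      e : ∀ M d c → 4 * ((M + d) * c) ≡ (4 * M + 4 * d) * c
      e = solve-∀
      e′ : ∀ M c → (4 * M + M) * c ≡ 5 * (M * c)
      e′ = solve-∀

    -- The risk is at most `1 / 2` by `half`, and at most `5 / 8` after the inflation by sampling.
    good-bound : 3 * M ≤ 8 * good
    good-bound = +-cancelʳ-≤ (8 * bad) (3 * M) (8 * good) (begin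
      3 * M + 8 * bad      ≤⟨ +-monoʳ-≤ (3 * M) (*-cancelˡ-≤ d (begin
        d * (8 * bad)        ≡⟨ e d bad ⟩
        2 * (4 * (d * bad))  ≤⟨ *-monoʳ-≤ 2 bad-bound ⟩
        2 * (5 * (M * c))    ≡⟨ e′ M c ⟩
        5 * M * (2 * c)      ≤⟨ *-monoʳ-≤ (5 * M) half ⟩
        5 * M * d            ≡⟨ *-comm (5 * M) d ⟩
        d * (5 * M)          ∎)) ⟩
      3 * M + 5 * M        ≡⟨ e″ M ⟩
      8 * M                ≡⟨ cong (8 *_) total ⟨
      8 * (good + bad)     ≡⟨ *-distribˡ-+ 8 good bad ⟩
      8 * good + 8 * bad   ∎)
      where
      e : ∀ d b → d * (8 * b) ≡ 2 * (4 * (d * b))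
      e = solve-∀
      e′ : ∀ M c → 2 * (5 * (M * c)) ≡ 5 * M * (2 * c)
      e′ = solve-∀
      e″ : ∀ M → 3 * M + 5 * M ≡ 8 * M
      e″ = solve-∀

    trade : bad * B ≤ good * (suc k * (c * ρ))
    trade = *-cancelˡ-≤ (32 * d) {{m*n≢0 32 d}} (begin
      32 * d * (bad * B)                       ≡⟨ e₁ d bad B ⟩
      8 * (4 * (d * bad)) * B                  ≤⟨ *-mono-≤ (*-monoʳ-≤ 8 bad-bound) B≤ ⟩
      8 * (5 * (M * c)) * (4 * (U * δ))        ≡⟨ e₂ M c (U * δ) ⟩
      160 * (M * c) * (U * δ)                  ≤⟨ *-monoʳ-≤ (160 * (M * c)) (begin
        U * δ                                    ≤⟨ *-monoˡ-≤ δ U≤ ⟩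
        2 * ρ * s * δ                            ≡⟨ *-assoc (2 * ρ) s δ ⟩
        2 * ρ * (s * δ)                          ≤⟨ *-monoʳ-≤ (2 * ρ) dense ⟩
        2 * ρ * (2 * d)                          ∎) ⟩
      160 * (M * c) * (2 * ρ * (2 * d))        ≡⟨ e₃ M c ρ d ⟩
      -- Here 54 arises, as the least integer above `160 / 3`: `4 * 54 * 3` is 648, just over 640.
      640 * (M * (c * ρ) * d)                  ≤⟨ *-monoˡ-≤ (M * (c * ρ) * d) (m≤m+n 640 8) ⟩
      648 * (M * (c * ρ) * d)                  ≡⟨ e₄ M (c * ρ) d ⟩
      4 * d * (54 * (c * ρ)) * (3 * M)         ≤⟨ *-mono-≤ (*-monoʳ-≤ (4 * d) (*-monoˡ-≤ (c * ρ) k-large)) good-bound ⟩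
      4 * d * (suc k * (c * ρ)) * (8 * good)   ≡⟨ e₅ d (suc k * (c * ρ)) good ⟩
      32 * d * (good * (suc k * (c * ρ)))      ∎)
      where
      e₁ : ∀ d b B → 32 * d * (b * B) ≡ 8 * (4 * (d * b)) * B
      e₁ = solve-∀
      e₂ : ∀ M c u → 8 * (5 * (M * c)) * (4 * u) ≡ 160 * (M * c) * u
      e₂ = solve-∀
      e₃ : ∀ M c ρ d → 160 * (M * c) * (2 * ρ * (2 * d)) ≡ 640 * (M * (c * ρ) * d)
      e₃ = solve-∀
      e₄ : ∀ M x d → 648 * (M * x * d) ≡ 4 * d * (54 * x) * (3 * M)
      e₄ = solve-∀
      e₅ : ∀ d x g → 4 * d * x * (8 * g) ≡ 32 * d * (g * x)
      e₅ = solve-∀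

  budget-step : M * B ^ suc k ≤ good * (B + c * ρ) ^ suc k
  budget-step = begin
    M * B ^ suc k                                          ≡⟨ cong (_* B ^ suc k) total ⟨
    (good + bad) * (B * B ^ k)                             ≡⟨ e good bad B (B ^ k) ⟩
    good * (B * B ^ k) + bad * B * B ^ k                   ≤⟨ +-monoʳ-≤ (good * (B * B ^ k)) (*-monoˡ-≤ (B ^ k) trade) ⟩
    good * (B * B ^ k) + good * (suc k * (c * ρ)) * B ^ k  ≡⟨ e′ good (B * B ^ k) (suc k * (c * ρ)) (B ^ k) ⟩
    good * (B ^ suc k + suc k * (c * ρ) * B ^ k)           ≤⟨ *-monoʳ-≤ good (bernoulli k B (c * ρ)) ⟩
    good * (B + c * ρ) ^ suc k                             ∎
    where
    e : ∀ g b B p → (g + b) * (B * p) ≡ g * (B * p) + b * B * p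
    e = solve-∀
    e′ : ∀ g a b p → g * a + g * b * p ≡ g * (a + b * p)
    e′ = solve-∀

class : (Fin n → Fin N) → Fin N → Fin n → Bool
class lab p u = lab u == p

classSize : (Fin n → Fin N) → Fin N → ℕ
classSize lab p = sum (χ (class lab p))

merge : ∀ {p q : Fin (suc N)} → q ≢ p → Fin (suc N) → Fin N
merge {q = q} q≢p x with q Fin.≟ x
... | yes _  = Fin.punchOut q≢p
... | no q≢x = Fin.punchOut q≢x

merge-glues : ∀ {p q : Fin (suc N)} (q≢p : q ≢ p) → merge q≢p q ≡ merge q≢p p
merge-glues {p = p} {q} q≢p with q Fin.≟ q | q Fin.≟ p
... | yes _  | no q≢p′ = Fin.punchOut-cong q refl
... | yes _  | yes q≡p = contradiction q≡p q≢p
... | no q≢q | _       = contradiction refl q≢q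

merge-factors : ∀ {A : Set} {p q : Fin (suc N)} (q≢p : q ≢ p) (f : Fin (suc N) → A) → f q ≡ f p →
                ∀ x → f (Fin.punchIn q (merge q≢p x)) ≡ f x
merge-factors {q = q} q≢p f e x with q Fin.≟ x
... | yes refl = trans (cong f (Fin.punchIn-punchOut q≢p)) (sym e)
... | no q≢x   = cong f (Fin.punchIn-punchOut q≢x)

merge-punchIn : ∀ {p q : Fin (suc N)} (q≢p : q ≢ p) ℓ → merge q≢p (Fin.punchIn q ℓ) ≡ ℓ
merge-punchIn {q = q} q≢p ℓ with q Fin.≟ Fin.punchIn q ℓ
... | yes e  = contradiction (sym e) (Fin.punchInᵢ≢i q ℓ)
... | no q≢x = trans (Fin.punchOut-cong q refl) (Fin.punchOut-punchIn q)

smallestClass : (Fin n → Fin N) → Maybe (Fin N)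
smallestClass {N = N} lab = lightest (λ _ → true) (classSize lab) (List.allFin N)

module Contract (d : Fin n) (L δ : ℕ) where

  unknown : Matrix n
  unknown _ _ = 0

  -- Every merge removes one class, so the number of classes is the recursion measure and bounds the
  -- number of rounds.
  contract     : ∀ N → (Fin n → Fin N) → Routine n (Σ ℕ λ N → Fin n → Fin N)
  contractFrom : ∀ N → (Fin n → Fin (suc N)) → Maybe (Fin (suc N)) → Routine n (Σ ℕ λ N → Fin n → Fin N)
  contractAt   : ∀ N → (Fin n → Fin (suc N)) → Fin (suc N) → ℕ → Routine n (Σ ℕ λ N → Fin n → Fin N)
  mergeInto    : ∀ N (lab : Fin n → Fin (suc N)) (p : Fin (suc N)) (w : Fin n) → Dec (lab w ≡ p) → Routine n (Σ ℕ λ N → Fin n → Fin N)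
  contract zero    lab k = k (zero , lab)
  contract (suc N) lab   = contractFrom N lab (smallestClass lab)
  contractFrom N lab nothing  k = k (suc N , lab)
  contractFrom N lab (just p) k = if 2 * classSize lab p ≤ᵇ δ
    then askCut (class lab p) (λ c → contractAt N lab p c k)
    else k (suc N , lab)
  -- No edge leaves the class. When the analysis applies, a picked class has at least `δ > 0`
  -- outgoing edges.
  contractAt N lab p zero      k = k (suc N , lab)
  -- 2 ^ (2 + c) is at least 4 c, so reducing modulo c inflates probabilities by at most 5 / 4.
  contractAt N lab p c@(suc _) k = sample (2 + c) λ r →
    -- Only the outer end of the random edge determines the merge. It is drawn with weight equal to
    -- its number of edges into the class, so one search suffices.
    pickVertex d L unknown (∁ (class lab p)) (class lab p) (r % c) λ w → mergeInto N lab p w (lab w Fin.≟ p) k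
  mergeInto N lab p w (yes _)   k = k (suc N , lab)
  mergeInto N lab p w (no w≢p)  k = contract N (merge w≢p ∘ lab) k

  module _ (G : Graph n) where

    contract-cost : ∀ {t} N lab {k} → (∀ s → queries G (k s) ≤ t) → queries G (contract N lab k) ≤ N * (1 + L * 3) + t
    contractFrom-cost : ∀ {t} N lab m {k} → (∀ s → queries G (k s) ≤ t) → queries G (contractFrom N lab m k) ≤ suc N * (1 + L * 3) + t
    contract-cost zero lab h = h _
    contract-cost (suc N) lab h = contractFrom-cost N lab (smallestClass lab) h
    contractFrom-cost N lab nothing h = ≤-trans (h _) (m≤n+m _ _)
    contractFrom-cost {t} N lab (just p) {k} h with 2 * classSize lab p ≤ᵇ δ
    ... | false = ≤-trans (h _) (m≤n+m t _)
    ... | true  = s≤s (at (cut G (tabulate (class lab p))))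
      where
      open ≤-Reasoning
      budget = L * 3 + N * (1 + L * 3) + t
      into : ∀ w e → queries G (mergeInto N lab p w e k) ≤ N * (1 + L * 3) + t
      into w (yes _)  = ≤-trans (h _) (m≤n+m t _)
      into w (no w≢p) = contract-cost N (merge w≢p ∘ lab) h
      at : ∀ c → queries G (contractAt N lab p c k) ≤ budget
      at zero      = ≤-trans (h _) (m≤n+m t _)
      at c@(suc _) = sample-queries (2 + c) λ r → begin
        queries G (pickVertex d L unknown (∁ (class lab p)) (class lab p) (r % c) (λ w → mergeInto N lab p w (lab w Fin.≟ p) k))
          ≤⟨ cost (pickVertex-computes d L unknown (∁ (class lab p)) (class lab p) (r % c) G) (λ w → mergeInto N lab p w (lab w Fin.≟ p) k) ⟩
        L * 3 + queries G (mergeInto N lab p (w r) (lab (w r) Fin.≟ p) k)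
          ≤⟨ +-monoʳ-≤ (L * 3) (into (w r) (lab (w r) Fin.≟ p)) ⟩
        L * 3 + (N * (1 + L * 3) + t)
          ≡⟨ +-assoc (L * 3) _ t ⟨
        budget ∎
        where
        w : ℕ → Fin n
        w r = picked d L unknown (∁ (class lab p)) (class lab p) (r % c) G

    -- An average does not exceed the worst branch. This is the bound that remains once a draw has
    -- destroyed the cut.
    contract-≤ : ∀ {y} N lab {k} → (∀ s → failProb G (k s) ≤q y) → failProb G (contract N lab k) ≤q y
    contractFrom-≤ : ∀ {y} N lab m {k} → (∀ s → failProb G (k s) ≤q y) → failProb G (contractFrom N lab m k) ≤q y
    contract-≤ zero lab h = h _
    contract-≤ (suc N) lab h = contractFrom-≤ N lab (smallestClass lab) h
    contractFrom-≤ N lab nothing h = h _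
    contractFrom-≤ {y} N lab (just p) {k} h with 2 * classSize lab p ≤ᵇ δ
    ... | false = h _
    ... | true  = at (cut G (tabulate (class lab p)))
      where
      into : ∀ w e → failProb G (mergeInto N lab p w e k) ≤q y
      into w (yes _)  = h _
      into w (no w≢p) = contract-≤ N (merge w≢p ∘ lab) h
      at : ∀ c → failProb G (contractAt N lab p c k) ≤q y
      at zero      = h _
      at c@(suc _) = failsBy⇒≤ {D = 2 ^ (2 + c) * 1} {{m*n≢0 (2 ^ (2 + c)) 1 {{m^n≢0 2 (2 + c)}}}}
        (failsBy-weaken′ (sample-fails (2 + c) {w = λ _ → 0} λ r → failsBy-¬ (subst (_≤q y)
          (sym (fail (pickVertex-computes d L unknown (∁ (class lab p)) (class lab p) (r % c) G) (λ w → mergeInto N lab p w (lab w Fin.≟ p) k)))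
          (into (w r) (lab (w r) Fin.≟ p)))))
        where
        w : ℕ → Fin n
        w r = picked d L unknown (∁ (class lab p)) (class lab p) (r % c) G
        failsBy-weaken′ : ∀ {D F} → FailsBy D (Σ< (2 ^ (2 + c)) (λ _ → 0)) F y → FailsBy D 0 F y
        failsBy-weaken′ {D} {F} = subst (λ s → FailsBy D s F y) (trans (Σ<-const (2 ^ (2 + c)) 0) (*-zeroʳ (2 ^ (2 + c))))

record Respects (X : Fin n → Bool) (lab : Fin n → Fin N) : Set where
  field
    side       : Fin N → Bool
    side-lab   : ∀ u → side (lab u) ≡ X u
    surjective : ∀ ℓ → ∃ λ u → lab u ≡ ℓ
open Respects public

merge-respects : ∀ {X : Fin n → Bool} {lab : Fin n → Fin (suc N)} {p q} (q≢p : q ≢ p) (R : Respects X lab) →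
                 side R q ≡ side R p → Respects X (merge q≢p ∘ lab)
merge-respects {lab = lab} {p} {q} q≢p R e = record
  { side = side R ∘ Fin.punchIn q
  ; side-lab = λ u → trans (merge-factors q≢p (side R) e (lab u)) (side-lab R u)
  ; surjective = λ ℓ → let u , eq = surjective R (Fin.punchIn q ℓ) in u , trans (cong (merge q≢p) eq) (merge-punchIn q≢p ℓ) }

classSize-positive : {lab : Fin n → Fin N} (u : Fin n) → 1 ≤ classSize lab (lab u)
classSize-positive {lab = lab} u = ≤-trans (≤-reflexive (cong ⟦_⟧ (sym (==-refl (lab u))))) (term≤sum (χ (class lab (lab u))) u)

classSize≤n : (lab : Fin n → Fin N) (p : Fin N) → classSize lab p ≤ n
classSize≤n {n} lab p = ≤-trans (sum-mono λ u → ⟦⟧≤1 (class lab p u)) (≤-reflexive (trans (sum-const n 1) (*-identityʳ n)))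

sum-classSize : (lab : Fin n → Fin N) → sum (classSize lab) ≡ n
sum-classSize {n} {N} lab = begin
  sum (λ p → sum λ u → ⟦ lab u == p ⟧)      ≡⟨ ∑-comm (λ p u → ⟦ lab u == p ⟧) ⟩
  sum (λ u → sum λ p → ⟦ lab u == p ⟧)      ≡⟨ (sum-cong-≗ λ u → trans (sum-cong-≗ λ p → sym (*-identityʳ ⟦ lab u == p ⟧)) (sum-δ (lab u) (λ _ → 1))) ⟩
  sum {n} (λ _ → 1)                         ≡⟨ trans (sum-const n 1) (*-identityʳ n) ⟩
  n                                         ∎
  where open ≡-Reasoning

few-classes : (lab : Fin n → Fin N) {δ : ℕ} → (∀ p → δ < 2 * classSize lab p) → N * δ ≤ 2 * n
few-classes {n} {N} lab {δ} large = begin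
  N * δ                          ≡⟨ sum-const N δ ⟨
  sum {N} (λ _ → δ)              ≤⟨ sum-mono (λ p → <⇒≤ (large p)) ⟩
  sum (λ p → 2 * classSize lab p) ≡⟨ *-distribˡ-sum 2 (classSize lab) ⟨
  2 * sum (classSize lab)        ≡⟨ cong (2 *_) (sum-classSize lab) ⟩
  2 * n                          ∎
  where open ≤-Reasoning

-- Boundaries of small classes, the risk of a draw, and the potential.

degree : Graph n → Fin n → ℕ
degree G u = sum (edges G u)

cutVal-∁ : ∀ {M : Matrix n} → Symmetric M → ∀ X → cutVal M (∁ X) ≡ cutVal M X
cutVal-∁ s X = trans (form-swap s) (form-cong (λ _ _ → refl) (λ u → cong ⟦_⟧ (Bool.not-involutive (X u))) (λ _ → refl))

-- Inside S, a vertex of a simple graph has at most |S| − 1 neighbours.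
boundary-large : (G : Graph n) {δ : ℕ} → (∀ u → δ ≤ degree G u) → ∀ S →
                 sum (χ S) * (1 + δ) ≤ sum (χ S) * sum (χ S) + cutVal (edges G) S
boundary-large {n} G {δ} min-degree S = begin
  s * (1 + δ)                                      ≡⟨ *-distribʳ-sum (1 + δ) (χ S) ⟩
  sum (λ u → χ S u * (1 + δ))                      ≤⟨ sum-mono each ⟩
  sum (λ u → χ S u * s + χ S u * out u)            ≡⟨ ∑-distrib-+ (λ u → χ S u * s) (λ u → χ S u * out u) ⟩
  sum (λ u → χ S u * s) + sum (λ u → χ S u * out u) ≡⟨ cong₂ _+_ (sym (*-distribʳ-sum s (χ S))) (sym form-rows) ⟩
  s * s + cutVal (edges G) S                       ∎
  where
  open ≤-Reasoning
  s = sum (χ S)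
  out : Fin n → ℕ
  out u = sum λ v → edges G u v * χ (∁ S) v
  inner : ∀ u → S u ≡ true → 1 + sum (λ v → edges G u v * χ S v) ≤ s
  inner u Su = begin
    1 + sum (λ v → edges G u v * χ S v)                          ≡⟨ cong (_+ sum (λ v → edges G u v * χ S v)) (sum-δ u (λ _ → 1)) ⟨
    sum (λ v → ⟦ u == v ⟧ * 1) + sum (λ v → edges G u v * χ S v) ≡⟨ ∑-distrib-+ (λ v → ⟦ u == v ⟧ * 1) (λ v → edges G u v * χ S v) ⟨
    sum (λ v → ⟦ u == v ⟧ * 1 + edges G u v * χ S v)             ≤⟨ sum-mono pointwise ⟩
    s ∎
    where
    pointwise : ∀ v → ⟦ u == v ⟧ * 1 + edges G u v * χ S v ≤ χ S v
    pointwise v with u Fin.≟ v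
    ... | yes refl rewrite irrefl G u = ≤-reflexive (cong ⟦_⟧ (sym Su))
    ... | no _     = ≤-trans (*-monoˡ-≤ (χ S v) (⟦⟧≤1 (adj G u v))) (≤-reflexive (+-identityʳ (χ S v)))
  each : ∀ u → χ S u * (1 + δ) ≤ χ S u * s + χ S u * out u
  each u with S u in Su
  ... | false = z≤n
  ... | true  = begin
    1 * (1 + δ)                                       ≡⟨ +-identityʳ (1 + δ) ⟩
    1 + δ                                             ≤⟨ +-monoʳ-≤ 1 (min-degree u) ⟩
    1 + degree G u                                    ≡⟨ cong (1 +_) (trans (sum-cong-≗ λ v → split (adj G u v) (S v)) (∑-distrib-+ (λ v → edges G u v * χ S v) (λ v → edges G u v * χ (∁ S) v))) ⟩
    1 + (sum (λ v → edges G u v * χ S v) + out u)     ≤⟨ +-monoˡ-≤ (out u) (inner u Su) ⟩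
    s + out u                                         ≡⟨ cong₂ _+_ (+-identityʳ s) (+-identityʳ (out u)) ⟨
    1 * s + 1 * out u                                 ∎
    where
    split : ∀ a b → ⟦ a ⟧ ≡ ⟦ a ⟧ * ⟦ b ⟧ + ⟦ a ⟧ * ⟦ not b ⟧
    split true  true  = refl
    split true  false = refl
    split false b     = refl

-- The hypothesis reads s (δ + 1 − s) ≤ d.
module _ {s δ d : ℕ} (large : s * (1 + δ) ≤ s * s + d) (1≤s : 1 ≤ s) (2s≤δ : 2 * s ≤ δ) where
  open ≤-Reasoning

  -- From `2 * s ≤ δ`, the factor `δ + 1 - s` is at least `δ / 2`.
  boundary-dense : s * δ ≤ 2 * d
  boundary-dense = +-cancelˡ-≤ (s * δ) (s * δ) (2 * d) (begin
    s * δ + s * δ                ≤⟨ m≤m+n _ (2 * s) ⟩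
    s * δ + s * δ + 2 * s        ≡⟨ e s δ ⟩
    2 * (s * (1 + δ))            ≤⟨ *-monoʳ-≤ 2 large ⟩
    2 * (s * s + d)              ≡⟨ e′ s d ⟩
    s * (2 * s) + 2 * d          ≤⟨ +-monoˡ-≤ (2 * d) (*-monoʳ-≤ s 2s≤δ) ⟩
    s * δ + 2 * d                ∎)
    where
    e : ∀ s δ → s * δ + s * δ + 2 * s ≡ 2 * (s * (1 + δ))
    e = solve-∀
    e′ : ∀ s d → 2 * (s * s + d) ≡ s * (2 * s) + 2 * d
    e′ = solve-∀

  -- The function `s (δ + 1 - s)` is concave in `s` and equals `δ` at `s = 1` and at `s = δ`. A
  -- picked class is therefore a heavier cut than a minimum cut below `δ`.
  boundary-exceeds-degree : δ ≤ d
  boundary-exceeds-degree = go 1≤s large 2s≤δ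
    where
    go : ∀ {s} → 1 ≤ s → s * (1 + δ) ≤ s * s + d → 2 * s ≤ δ → δ ≤ d
    go {suc t} _ large 2s≤δ = +-cancelˡ-≤ (suc t * suc t) δ d (begin
      suc t * suc t + δ            ≡⟨ e t δ ⟩
      1 + t + δ + t * (1 + t)      ≤⟨ +-monoʳ-≤ (1 + t + δ) (*-monoʳ-≤ t (≤-trans (m≤n*m (1 + t) 2) 2s≤δ)) ⟩
      1 + t + δ + t * δ            ≡⟨ e′ t δ ⟩
      suc t * (1 + δ)              ≤⟨ large ⟩
      suc t * suc t + d            ∎)
      where
      e : ∀ t δ → suc t * suc t + δ ≡ 1 + t + δ + t * (1 + t)
      e = solve-∀
      e′ : ∀ t δ → 1 + t + δ + t * δ ≡ suc t * (1 + δ)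
      e′ = solve-∀

module _ (G : Graph n) {X : Fin n → Bool} (min : IsMinCut G X) where

  private
    a = edges G

    opposite : Bool → Fin n → Bool
    opposite b u = b ⊻ X u

    opposite-cut : ∀ b → cutVal a (opposite b) ≡ cutVal a X
    opposite-cut false = refl
    opposite-cut true  = cutVal-∁ (edges-sym G) X

  -- If S is not a whole side of the minimum cut, moving S across it does not decrease the cut.
  half-crossing : ∀ S b → (∀ u → S u ≡ true → X u ≡ b) → cutVal a X < cutVal a S →
                  2 * form a (χ S) (χ (opposite b)) ≤ cutVal a S
  half-crossing S b inside X<S = cases (Fin.any? λ u → E u Bool.≟ true)
    where
    open ≤-Reasoning
    O E : Fin n → Bool
    O = opposite b
    -- `O` is the side of the minimum cut away from `S`, and `E` is what `S` leaves of the other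
    -- side. The cuts of `S`, `E` and `X` are each a sum of two of the three edge counts between
    -- these parts, so comparing `X` with `E` compares the edges from `S` to `O` with those from `S`
    -- to `E`.
    E = ∁ S ∩ ∁ O
    O-false : ∀ u → S u ≡ true → O u ≡ false
    O-false u Su = trans (cong (b ⊻_) (inside u Su)) (Bool.xor-same b)
    parts-S : ∀ s o → (s ≡ true → o ≡ false) → ⟦ not s ⟧ ≡ ⟦ not s ∧ not o ⟧ + ⟦ o ⟧
    parts-S true  o     f rewrite f refl = refl
    parts-S false true  f = refl
    parts-S false false f = refl
    parts-O : ∀ s o → (s ≡ true → o ≡ false) → ⟦ not o ⟧ ≡ ⟦ not s ∧ not o ⟧ + ⟦ s ⟧
    parts-O true  o     f rewrite f refl = refl
    parts-O false true  f = refl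
    parts-O false false f = refl
    parts-E : ∀ s o → (s ≡ true → o ≡ false) → ⟦ not (not s ∧ not o) ⟧ ≡ ⟦ s ⟧ + ⟦ o ⟧
    parts-E true  o     f rewrite f refl = refl
    parts-E false true  f = refl
    parts-E false false f = refl
    cut-S : cutVal a S ≡ form a (χ E) (χ S) + form a (χ S) (χ O)
    cut-S = trans (form-cong (λ _ _ → refl) (λ _ → refl) (λ u → parts-S (S u) (O u) (O-false u)))
      (trans form-+ʳ (cong (_+ form a (χ S) (χ O)) (form-swap (edges-sym G))))
    cut-E : cutVal a E ≡ form a (χ E) (χ S) + form a (χ E) (χ O)
    cut-E = trans (form-cong (λ _ _ → refl) (λ _ → refl) (λ u → parts-E (S u) (O u) (O-false u))) form-+ʳ
    cut-O : cutVal a X ≡ form a (χ S) (χ O) + form a (χ E) (χ O)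
    cut-O = begin-equality
      cutVal a X                                     ≡⟨ opposite-cut b ⟨
      cutVal a O                                     ≡⟨ form-swap (edges-sym G) ⟩
      form a (χ (∁ O)) (χ O)                         ≡⟨ form-cong (λ _ _ → refl) (λ u → parts-O (S u) (O u) (O-false u)) (λ _ → refl) ⟩
      form a (λ u → χ E u + χ S u) (χ O)             ≡⟨ form-+ˡ ⟩
      form a (χ E) (χ O) + form a (χ S) (χ O)        ≡⟨ +-comm (form a (χ E) (χ O)) _ ⟩
      form a (χ S) (χ O) + form a (χ E) (χ O)        ∎
    some-opposite : ∀ b → ∃ λ u → opposite b u ≡ true
    some-opposite true  = let v , q = proj₂ (proj₁ min) in v , cong not q
    some-opposite false = proj₁ (proj₁ min)
    cases : Dec (∃ λ u → E u ≡ true) → 2 * form a (χ S) (χ O) ≤ cutVal a S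
    cases (yes E∋) = begin
      2 * form a (χ S) (χ O)                             ≡⟨ cong (form a (χ S) (χ O) +_) (+-identityʳ _) ⟩
      form a (χ S) (χ O) + form a (χ S) (χ O)            ≤⟨ +-monoˡ-≤ (form a (χ S) (χ O)) (+-cancelʳ-≤ (form a (χ E) (χ O)) _ _ (begin
        form a (χ S) (χ O) + form a (χ E) (χ O)            ≡⟨ cut-O ⟨
        cutVal a X                                         ≤⟨ proj₂ min E (E∋ , E∌) ⟩
        cutVal a E                                         ≡⟨ cut-E ⟩
        form a (χ E) (χ S) + form a (χ E) (χ O)            ∎)) ⟩
      form a (χ E) (χ S) + form a (χ S) (χ O)            ≡⟨ cut-S ⟨
      cutVal a S                                         ∎
      where
      E∌ : ∃ λ u → E u ≡ false
      E∌ = let u , e = some-opposite b in u , trans (cong (λ o → not (S u) ∧ not o) e) (Bool.∧-zeroʳ (not (S u)))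
    -- With `E` empty, `S` is a whole side of the minimum cut, hence as light as `X`.
    cases (no ¬E) = contradiction (begin-strict
      cutVal a X   <⟨ X<S ⟩
      cutVal a S   ≡⟨ cutVal-cong a (λ u → whole (S u) (O u) (O-false u) (λ e → ¬E (u , e))) ⟩
      cutVal a (∁ O) ≡⟨ cutVal-∁ (edges-sym G) O ⟩
      cutVal a O   ≡⟨ opposite-cut b ⟩
      cutVal a X   ∎) (<-irrefl refl)
      where
      whole : ∀ s o → (s ≡ true → o ≡ false) → ¬ (not s ∧ not o ≡ true) → s ≡ not o
      whole true  o     f g = sym (cong not (f refl))
      whole false true  f g = refl
      whole false false f g = contradiction refl g

-- An integral substitute for `2 ^ n / s`. For `1 ≤ s ≤ n` it is at least this and less than twice
-- this, and it halves exactly when `s` doubles.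
rate : ℕ → ℕ → ℕ
rate n s = 2 ^ (n ∸ ⌊log₂ s ⌋)

rate-antitone : ∀ n {s t} → s ≤ t → rate n t ≤ rate n s
rate-antitone n s≤t = ^-monoʳ-≤ 2 (∸-monoʳ-≤ n (⌊log₂⌋-mono-≤ s≤t))

module _ {s : ℕ} (1≤s : 1 ≤ s) (s≤n : s ≤ n) where

  private
    log<n : ⌊log₂ s ⌋ < n
    log<n = <-≤-trans (n<2^n ⌊log₂ s ⌋) (≤-trans (2^⌊log₂n⌋≤n s 1≤s) s≤n)

  rate-halves : rate n s ≡ 2 * rate n (2 * s)
  rate-halves = trans (cong (2 ^_) (+-∸-assoc 1 log<n))
    (cong (λ l → 2 * 2 ^ (n ∸ l)) (sym (⌊log₂[2*b]⌋≡1+⌊log₂b⌋ s {{>-nonZero 1≤s}})))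

  -- Rounding the logarithm down can only raise the rate. This provides `U≤` in the budget step,
  -- with `U = 2 ^ n`.
  rate-lower : 2 ^ n ≤ 2 * rate n (2 * s) * s
  rate-lower = begin
    2 ^ n                                    ≡⟨ cong (2 ^_) (m∸n+n≡m (<⇒≤ log<n)) ⟨
    2 ^ (n ∸ ⌊log₂ s ⌋ + ⌊log₂ s ⌋)          ≡⟨ ^-distribˡ-+-* 2 (n ∸ ⌊log₂ s ⌋) ⌊log₂ s ⌋ ⟩
    rate n s * 2 ^ ⌊log₂ s ⌋                 ≤⟨ *-mono-≤ (≤-reflexive rate-halves) (2^⌊log₂n⌋≤n s 1≤s) ⟩
    2 * rate n (2 * s) * s                   ∎
    where open ≤-Reasoning

smallestClass-spec : (lab : Fin n → Fin (suc N)) →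
                     ∃ λ p → smallestClass lab ≡ just p × (∀ q → classSize lab p ≤ classSize lab q)
smallestClass-spec {N = N} lab = p , p-smallest , minimal
  where
  smaller : ∀ q → ∃ λ p → smallestClass lab ≡ just p × classSize lab p ≤ classSize lab q
  smaller q = lightest-min (λ _ → true) (classSize lab) (∈-allFin q) refl
  p = proj₁ (smaller zero)
  p-smallest = proj₁ (proj₂ (smaller zero))
  minimal : ∀ q → classSize lab p ≤ classSize lab q
  minimal q with smaller q
  ... | p′ , e , le = subst (λ x → classSize lab x ≤ classSize lab q) (just-injective (trans (sym e) p-smallest)) le

module Merged (lab : Fin n → Fin (suc N)) {p q : Fin (suc N)} (q≢p : q ≢ p) where

  merged : Fin n → Fin N
  merged = merge q≢p ∘ lab

  merged-grows : ∀ u → classSize lab (lab u) ≤ classSize merged (merged u)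
  merged-grows u = sum-mono λ v → ⟦⟧-mono (class lab (lab u) v) (class merged (merged u) v) λ t →
    subst T (sym (trans (cong (λ x → merge q≢p x == merged u) (==⇒≡ {u = lab v} (T⇒true t))) (==-refl (merged u)))) _

  merged-joins : ∀ u → lab u ≡ p → classSize lab p + classSize lab q ≤ classSize merged (merged u)
  merged-joins u refl = ≤-trans (≤-reflexive (sym (∑-distrib-+ (χ (class lab p)) (χ (class lab q))))) (sum-mono pointwise)
    where
    pointwise : ∀ v → χ (class lab p) v + χ (class lab q) v ≤ χ (class merged (merged u)) v
    pointwise v with lab v Fin.≟ p | lab v Fin.≟ q
    ... | yes e | yes e′ = contradiction (trans (sym e′) e) q≢p
    ... | yes e | no _   = ≤-reflexive (cong ⟦_⟧ (sym (trans (cong (λ x → merge q≢p x == merged u) e) (==-refl (merged u)))))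
    ... | no _  | yes e  = ≤-reflexive (cong ⟦_⟧ (sym (trans (cong (λ x → merge q≢p x == merged u) e)
                             (trans (cong (_== merged u) (merge-glues q≢p)) (==-refl (merged u))))))
    ... | no _  | no _   = z≤n

module _ (G : Graph n) (X : Fin n → Bool) where

  crossings : Fin n → ℕ
  crossings u = sum λ v → edges G u v * ⟦ X u ⊻ X v ⟧

  -- An upper bound, up to scale, for the probability that contraction destroys X:
  -- the class of u has to be picked at sizes that at least double each time.
  potential : (Fin n → Fin N) → ℕ
  potential lab = sum λ u → crossings u * rate n (classSize lab (lab u))

  sum-crossings : ∀ S b → (∀ u → S u ≡ true → X u ≡ b) → sum (λ u → χ S u * crossings u) ≡ form (edges G) (χ S) (χ (λ v → b ⊻ X v))
  sum-crossings S b inside = trans (sum-cong-≗ pointwise) (sym form-rows)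
    where
    pointwise : ∀ u → χ S u * crossings u ≡ χ S u * sum λ v → edges G u v * ⟦ b ⊻ X v ⟧
    pointwise u with S u in Su
    ... | false = refl
    ... | true  = cong (λ c → 1 * sum λ v → edges G u v * ⟦ c ⊻ X v ⟧) (inside u Su)

  sum-crossings-all : sum crossings ≡ 2 * cutVal (edges G) X
  sum-crossings-all = begin
    sum crossings                                                       ≡⟨ (sum-cong-≗ λ u → split (X u) (crossings u)) ⟩
    sum (λ u → χ X u * crossings u + χ (∁ X) u * crossings u)           ≡⟨ ∑-distrib-+ (λ u → χ X u * crossings u) (λ u → χ (∁ X) u * crossings u) ⟩
    sum (λ u → χ X u * crossings u) + sum (λ u → χ (∁ X) u * crossings u)
      ≡⟨ cong₂ _+_ (sum-crossings X true λ u e → e) (sum-crossings (∁ X) false λ u e → trans (sym (Bool.not-involutive (X u))) (cong not e)) ⟩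
    cutVal (edges G) X + form (edges G) (χ (∁ X)) (χ X)                 ≡⟨ cong (cutVal (edges G) X +_) (trans (form-swap (edges-sym G)) (sym (+-identityʳ _))) ⟩
    2 * cutVal (edges G) X ∎
    where
    open ≡-Reasoning
    split : ∀ x c → c ≡ ⟦ x ⟧ * c + ⟦ not x ⟧ * c
    split true  c = sym (trans (+-identityʳ _) (+-identityʳ c))
    split false c = sym (+-identityʳ c)

  potential-initial : potential id ≤ 2 * cutVal (edges G) X * 2 ^ n
  potential-initial = begin
    potential id                       ≤⟨ sum-mono (λ u → *-monoʳ-≤ (crossings u) (^-monoʳ-≤ 2 (m∸n≤m n ⌊log₂ classSize id u ⌋))) ⟩
    sum (λ u → crossings u * 2 ^ n)    ≡⟨ *-distribʳ-sum (2 ^ n) crossings ⟨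
    sum crossings * 2 ^ n              ≡⟨ cong (_* 2 ^ n) sum-crossings-all ⟩
    2 * cutVal (edges G) X * 2 ^ n     ∎
    where open ≤-Reasoning

  -- The members of `p` land in a class of at least twice the size, because `q` is no smaller than
  -- `p`; their rate drops from `2 * ρ` to at most `ρ`, which frees one `ρ` per crossing edge at
  -- `p`. No other rate increases.
  potential-merge : ∀ (lab : Fin n → Fin (suc N)) {p q} (q≢p : q ≢ p) → 1 ≤ classSize lab p → classSize lab p ≤ classSize lab q →
                    potential (merge q≢p ∘ lab) + sum (λ u → χ (class lab p) u * crossings u) * rate n (2 * classSize lab p) ≤ potential lab
  potential-merge lab {p} {q} q≢p 1≤s s≤t = begin
    potential merged + sum (λ u → χ S u * crossings u) * ρ            ≡⟨ cong (potential merged +_) (*-distribʳ-sum ρ (λ u → χ S u * crossings u)) ⟩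
    potential merged + sum (λ u → χ S u * crossings u * ρ)            ≡⟨ ∑-distrib-+ (λ u → crossings u * rate n (classSize merged (merged u))) (λ u → χ S u * crossings u * ρ) ⟨
    sum (λ u → crossings u * rate n (classSize merged (merged u)) + χ S u * crossings u * ρ) ≤⟨ sum-mono pointwise ⟩
    potential lab ∎
    where
    open ≤-Reasoning
    open Merged lab q≢p
    S = class lab p
    s = classSize lab p
    ρ = rate n (2 * s)
    arith : ∀ c ρ → c * ρ + 1 * c * ρ ≡ c * (2 * ρ)
    arith = solve-∀
    pointwise : ∀ u → crossings u * rate n (classSize merged (merged u)) + χ S u * crossings u * ρ ≤ crossings u * rate n (classSize lab (lab u))
    pointwise u with lab u Fin.≟ p
    ... | no _     = ≤-trans (≤-reflexive (+-identityʳ _)) (*-monoʳ-≤ (crossings u) (rate-antitone n (merged-grows u)))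
    ... | yes lab≡ = begin
      crossings u * rate n (classSize merged (merged u)) + 1 * crossings u * ρ
        ≤⟨ +-monoˡ-≤ (1 * crossings u * ρ) (*-monoʳ-≤ (crossings u) (rate-antitone n (≤-trans (+-monoʳ-≤ s (≤-trans (≤-reflexive (+-identityʳ s)) s≤t)) (merged-joins u lab≡)))) ⟩
      crossings u * ρ + 1 * crossings u * ρ      ≡⟨ arith (crossings u) ρ ⟩
      crossings u * (2 * ρ)                      ≡⟨ cong (crossings u *_) (rate-halves 1≤s (classSize≤n lab p)) ⟨
      crossings u * rate n s                     ≡⟨ cong (λ x → crossings u * rate n (classSize lab x)) lab≡ ⟨
      crossings u * rate n (classSize lab (lab u)) ∎

module Survival (d : Fin n) (L δ k : ℕ) (n≤2^L : n ≤ 2 ^ L) (k-large : 54 ≤ suc k) (G : Graph n) (X : Fin n → Bool)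
         (min : IsMinCut G X) (light : cutVal (edges G) X < δ) (min-degree : ∀ u → δ ≤ degree G u) where

  open Contract d L δ

  private
    a = edges G

  -- The initial potential is at most `2 * δ * 2 ^ n`, half of this; the other half is the initial
  -- budget.
  scale : ℕ
  scale = 4 * (2 ^ n * δ)

  module _ {y : ℚ} {κ : (Σ ℕ λ N → Fin n → Fin N) → Alg n} (y≥0 : 0ℚ ≤q y) (κ≤y : ∀ s → failProb G (κ s) ≤q y)
           (κ-good : ∀ {N} (lab : Fin n → Fin N) → Respects X lab → (∀ p → δ < 2 * classSize lab p) → failProb G (κ (N , lab)) ≤q 0ℚ) where

    Survives : ℕ → Alg n → Set
    Survives B A = FailsBy (scale ^ suc k) (B ^ suc k) (failProb G A) y

    -- A good draw moves `Δ` from the potential to the budget, so the invariant persists and the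
    -- credit becomes `(B + Δ) ^ suc k`. By `budget-step`, this credit on the good draws alone still
    -- averages at least `B ^ suc k`. Once all classes are large the continuation never fails, and
    -- `B ≤ scale` suffices.
    contract-survives : ∀ N (lab : Fin n → Fin N) → Respects X lab → ∀ B → B + potential G X lab ≤ scale → Survives B (contract N lab κ)
    contract-survives zero lab R B _ with () ← lab d
    contract-survives (suc N) lab R B B+Φ≤ with smallestClass-spec lab
    ... | p , p-smallest , minimal = subst (λ m → Survives B (contractFrom N lab m κ)) (sym p-smallest) (from (2 * s ≤ᵇ δ) refl)
      where
      S : Fin n → Bool
      S = class lab p
      s = classSize lab p
      b = side R p
      O : Fin n → Bool
      O v = b ⊻ X v
      c = form a (χ S) (χ O)
      ρ = rate n (2 * s)
      Δ = c * ρ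
      weights : Fin n → ℕ
      weights = weight d L unknown (∁ S) S 0 G

      B≤scale : B ≤ scale
      B≤scale = ≤-trans (m≤m+n B _) B+Φ≤

      inside : ∀ u → S u ≡ true → X u ≡ b
      inside u Su = trans (sym (side-lab R u)) (cong (side R) (==⇒≡ {u = lab u} Su))

      1≤s : 1 ≤ s
      1≤s = let u , e = surjective R p in subst (λ p → 1 ≤ classSize lab p) e (classSize-positive {lab = lab} u)

      S-disjoint : Disjoint (∁ S) S
      S-disjoint u = Bool.∧-inverseˡ (S u)

      sum-weights : sum weights ≡ cutVal a S
      sum-weights = trans (sum-weight d L unknown (∁ S) S 0 G) (form-swap (edges-sym G))

      weights-bad : sum (λ w → weights w * χ O w) ≡ c
      weights-bad = trans (sum-cong-≗ pointwise) (trans (sym form-rows) (form-swap (edges-sym G)))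
        where
        pointwise : ∀ w → weights w * χ O w ≡ χ O w * sum λ v → a w v * χ S v
        pointwise w with S w in Sw | O w in Ow
        ... | false | o = trans (cong (_* ⟦ o ⟧) (+-identityʳ (sum λ v → a w v * χ S v))) (*-comm _ ⟦ o ⟧)
        ... | true  | false = refl
        ... | true  | true  with () ← trans (sym Ow) (trans (cong (b ⊻_) (inside w Sw)) (Bool.xor-same b))

      from : ∀ t → (2 * s ≤ᵇ δ) ≡ t → Survives B (contractFrom N lab (just p) κ)
      at : 2 * s ≤ δ → ∀ e → e ≡ cutVal a S → Survives B (contractAt N lab p e κ)
      from false small = subst (λ t → Survives B (if t then askCut S (λ e → contractAt N lab p e κ) else κ (suc N , lab))) (sym small)
        (failsBy-weaken y≥0 (^-monoˡ-≤ (suc k) B≤scale) (failsBy-0 (κ-good lab R λ q →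
          <-≤-trans (≰⇒> λ le → subst T small (≤⇒≤ᵇ le)) (*-monoʳ-≤ 2 (minimal q)))))
      from true small = subst (λ t → Survives B (if t then askCut S (λ e → contractAt N lab p e κ) else κ (suc N , lab))) (sym small)
        (subst (λ F → FailsBy (scale ^ suc k) (B ^ suc k) F y) (sym (fail (askCut-computes {G = G} S) (λ e → contractAt N lab p e κ)))
          (at (≤ᵇ⇒≤ (2 * s) δ (subst T (sym small) _)) (cutVal a S) refl))
      at small zero e = contradiction (≤-trans (boundary-exceeds-degree (boundary-large G min-degree S) 1≤s small) (≤-reflexive (sym e)))
        (<⇒≱ (≤-<-trans z≤n light))
      at small e@(suc _) e≡ = failsBy-cancel M {{m^n≢0 2 (2 + e)}}
        (failsBy-weaken y≥0 (≤-trans (budget-step {s = s} k-large total counted fine half B≤scale dense (rate-lower 1≤s (classSize≤n lab p)))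
            (≤-reflexive (sym (Σ<-*ʳ M (λ r → χ (∁ O) (w r)) ((B + Δ) ^ suc k)))))
          (sample-fails (2 + e) each))
        where
        M = 2 ^ (2 + e)
        w : ℕ → Fin n
        w r = picked d L unknown (∁ S) S (r % e) G
        bad = Σ< M (λ r → χ O (w r))
        good = Σ< M (λ r → χ (∁ O) (w r))
        e≡weights : e ≡ sum weights
        e≡weights = trans e≡ (sym sum-weights)
        w≡ : ∀ r → w r ≡ pick d L weights (r % e)
        w≡ r = picked≡pick d L unknown (∁ S) S (r % e) G (λ _ _ → z≤n) S-disjoint
        total : good + bad ≡ M
        total = trans (sym (Σ<-+ M (λ r → χ (∁ O) (w r)) (λ r → χ O (w r))))
          (trans (Σ<-cong M λ r _ → trans (+-comm (χ (∁ O) (w r)) _) (χ+χ∁ O (w r))) (trans (Σ<-const M 1) (*-identityʳ M)))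
        counted : e * bad ≤ (M + e) * c
        counted = begin
          e * bad                                               ≡⟨ cong (e *_) (Σ<-cong M λ r _ → cong (χ O) (w≡ r)) ⟩
          e * Σ< M (λ r → χ O (pick d L weights (r % e)))       ≤⟨ Σ<-mod M e (χ O ∘ pick d L weights) ⟩
          (M + e) * Σ< e (χ O ∘ pick d L weights)               ≡⟨ cong (λ i → (M + e) * Σ< i (χ O ∘ pick d L weights)) e≡weights ⟩
          (M + e) * Σ< (sum weights) (χ O ∘ pick d L weights)   ≡⟨ cong ((M + e) *_) (trans (pick-count d L weights n≤2^L (χ O)) weights-bad) ⟩
          (M + e) * c                                           ∎
          where open ≤-Reasoning
        fine : 4 * e ≤ M
        fine = ≤-trans (*-monoʳ-≤ 4 (<⇒≤ (n<2^n e))) (≤-reflexive (*-assoc 2 2 (2 ^ e)))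
        X<S : cutVal a X < cutVal a S
        X<S = <-≤-trans light (boundary-exceeds-degree (boundary-large G min-degree S) 1≤s small)
        half : 2 * c ≤ e
        half = ≤-trans (half-crossing G min S b inside X<S) (≤-reflexive (sym e≡))
        dense : s * δ ≤ 2 * e
        dense = ≤-trans (boundary-dense (boundary-large G min-degree S) 1≤s small) (≤-reflexive (cong (2 *_) (sym e≡)))
        outside : ∀ r → S (w r) ≡ false
        outside r = not-true⇒false (χ-true {X = ∁ S} {w r} (0<m*n⇒0<m (subst (λ v → 0 < weights v) (sym (w≡ r))
          (pick-positive d L weights n≤2^L (subst (r % e <_) e≡weights (m%n<n r e))))))
        into : ∀ v (q? : Dec (lab v ≡ p)) → S v ≡ false → ∀ o → O v ≡ o →
               FailsBy (scale ^ suc k) (⟦ not o ⟧ * (B + Δ) ^ suc k) (failProb G (mergeInto N lab p v q? κ)) y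
        into v (yes q≡p) Sv o Ov = contradiction (trans (sym Sv) (trans (cong (_== p) q≡p) (==-refl p))) λ ()
        -- The drawn edge lies in `X`: no credit is claimed, and only the bound `y` on the
        -- continuation is left.
        into v (no q≢p) Sv true Ov = failsBy-¬ (contract-≤ G N (merge q≢p ∘ lab) κ≤y)
        into v (no q≢p) Sv false Ov = failsBy-weaken y≥0 (≤-reflexive (+-identityʳ _))
          (contract-survives N (merge q≢p ∘ lab) (merge-respects q≢p R (trans (side-lab R v) (⊻-false b (X v) Ov))) (B + Δ) (begin
            B + Δ + potential G X (merge q≢p ∘ lab)    ≡⟨ +-assoc B Δ _ ⟩
            B + (Δ + potential G X (merge q≢p ∘ lab))  ≡⟨ cong (B +_) (+-comm Δ _) ⟩
            B + (potential G X (merge q≢p ∘ lab) + Δ)  ≤⟨ +-monoʳ-≤ B (≤-trans (≤-reflexive (cong (λ c → potential G X (merge q≢p ∘ lab) + c * ρ) (sym (sum-crossings G X S b inside))))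
                                                            (potential-merge G X lab q≢p 1≤s (minimal (lab v)))) ⟩
            B + potential G X lab                      ≤⟨ B+Φ≤ ⟩
            scale                                      ∎))
          where
          open ≤-Reasoning
          ⊻-false : ∀ b x → b ⊻ x ≡ false → x ≡ b
          ⊻-false true  true  _ = refl
          ⊻-false false false _ = refl
        each : ∀ r → FailsBy (scale ^ suc k) (χ (∁ O) (w r) * (B + Δ) ^ suc k)
                 (failProb G (pickVertex d L unknown (∁ S) S (r % e) λ v → mergeInto N lab p v (lab v Fin.≟ p) κ)) y
        each r = subst (λ F → FailsBy (scale ^ suc k) (χ (∁ O) (w r) * (B + Δ) ^ suc k) F y)
          (sym (fail (pickVertex-computes d L unknown (∁ S) S (r % e) G) (λ v → mergeInto N lab p v (lab v Fin.≟ p) κ)))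
          (into (w r) (lab (w r) Fin.≟ p) (outside r) (O (w r)) refl)

-- Amplification

^-distribˡ-* : ∀ a b m → (a * b) ^ m ≡ a ^ m * b ^ m
^-distribˡ-* a b zero    = refl
^-distribˡ-* a b (suc m) = trans (cong (a * b *_) (^-distribˡ-* a b m)) (e a b (a ^ m) (b ^ m))
  where
  e : ∀ a b p q → a * b * (p * q) ≡ a * p * (b * q)
  e = solve-∀

-- By Bernoulli `(P / (P + 1)) ^ (P + 1) ≤ 1 / 2`, so each round of `suc P` trials halves the
-- failure, and `L` rounds bring it to `1 / n`.
decay : ∀ P L n → n ≤ 2 ^ L → P ^ (suc P * L) * n ≤ suc P ^ (suc P * L)
decay P L n n≤ = begin
  P ^ (suc P * L) * n               ≤⟨ *-monoʳ-≤ (P ^ (suc P * L)) n≤ ⟩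
  P ^ (suc P * L) * 2 ^ L           ≡⟨ cong (_* 2 ^ L) (^-*-assoc P (suc P) L) ⟨
  (P ^ suc P) ^ L * 2 ^ L           ≡⟨ ^-distribˡ-* (P ^ suc P) 2 L ⟨
  (P ^ suc P * 2) ^ L               ≤⟨ ^-monoˡ-≤ L doubles ⟩
  (suc P ^ suc P) ^ L               ≡⟨ ^-*-assoc (suc P) (suc P) L ⟩
  suc P ^ (suc P * L)               ∎
  where
  open ≤-Reasoning
  e : ∀ P p → P * p * 2 ≡ P * p + P * 1 * p
  e = solve-∀
  doubles : P ^ suc P * 2 ≤ suc P ^ suc P
  doubles = begin
    P ^ suc P * 2                     ≡⟨ e P (P ^ P) ⟩
    P ^ suc P + P * 1 * P ^ P         ≤⟨ +-monoʳ-≤ (P ^ suc P) (*-monoˡ-≤ (P ^ P) (*-monoˡ-≤ 1 (n≤1+n P))) ⟩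
    P ^ suc P + suc P * 1 * P ^ P     ≤⟨ bernoulli P P 1 ⟩
    (P + 1) ^ suc P                   ≡⟨ cong (_^ suc P) (+-comm P 1) ⟩
    suc P ^ suc P                     ∎

shrink : ℕ → ℚ
shrink P = fromℚᵘ (mkℚᵘ (ℤ.+ P) P)

shrink-spec : ∀ P → ℕ→ℚ (suc P) *q shrink P ≡ ℕ→ℚ P
shrink-spec P = ℚ.toℚᵘ-injective (begin
  toℚᵘ (ℕ→ℚ (suc P) *q shrink P)             ≈⟨ ℚ.toℚᵘ-homo-* (ℕ→ℚ (suc P)) (shrink P) ⟩
  toℚᵘ (ℕ→ℚ (suc P)) ℚᵘ.* toℚᵘ (shrink P)    ≈⟨ ℚᵘ.*-cong (ℚ.toℚᵘ-fromℚᵘ (mkℚᵘ (ℤ.+ suc P) 0)) (ℚ.toℚᵘ-fromℚᵘ (mkℚᵘ (ℤ.+ P) P)) ⟩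
  mkℚᵘ (ℤ.+ suc P) 0 ℚᵘ.* mkℚᵘ (ℤ.+ P) P     ≈⟨ *≡* (trans (ℤ.*-identityʳ _) (trans (ℤ.*-comm (ℤ.+ suc P) (ℤ.+ P)) (cong (λ j → ℤ.+ P ℤ.* ℤ.+ suc j) (sym (+-identityʳ P))))) ⟩
  mkℚᵘ (ℤ.+ P) 0                             ≈⟨ ℚ.toℚᵘ-fromℚᵘ (mkℚᵘ (ℤ.+ P) 0) ⟨
  toℚᵘ (ℕ→ℚ P)                               ∎)
  where open import Relation.Binary.Reasoning.Setoid ℚᵘ.≃-setoid

shrink-≥0 : ∀ P → 0ℚ ≤q shrink P
shrink-≥0 P = ℚ.*-cancelˡ-≤-pos (ℕ→ℚ (suc P)) {{ℕ→ℚ-pos P}}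
  (subst₂ _≤q_ (sym (ℚ.*-zeroʳ (ℕ→ℚ (suc P)))) (sym (shrink-spec P)) (ℕ→ℚ-≤ {0} {P} z≤n))

shrink^-≥0 : ∀ P j → 0ℚ ≤q shrink P ^q j
shrink^-≥0 P zero    = ℕ→ℚ-≤ {0} {1} z≤n
shrink^-≥0 P (suc j) = subst (_≤q shrink P *q shrink P ^q j) (ℚ.*-zeroʳ (shrink P))
  (ℚ.*-monoˡ-≤-nonNeg (shrink P) {{ℚ.nonNegative (shrink-≥0 P)}} (shrink^-≥0 P j))

module _ where
  open ℚ.≤-Reasoning
  open Data.Rational.Solver.+-*-Solver

  failsBy⇒shrink : ∀ P {F y} → FailsBy (suc P) 1 F y → F ≤q shrink P *q y
  failsBy⇒shrink P {F} {y} b = ℚ.*-cancelˡ-≤-pos sP {{ℕ→ℚ-pos P}} (begin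
    sP *q F                              ≡⟨ solve 3 (λ p f y → p :* f := p :* f :+ con 1ℚ :* y :+ (con (ℚ.- 1ℚ) :* y)) refl sP F y ⟩
    sP *q F +q 1ℚ *q y +q (ℚ.- 1ℚ *q y)  ≤⟨ ℚ.+-monoˡ-≤ (ℚ.- 1ℚ *q y) (fails-bound b) ⟩
    sP *q y +q (ℚ.- 1ℚ *q y)             ≡⟨ cong (λ x → x *q y +q (ℚ.- 1ℚ *q y)) (ℕ→ℚ-+ 1 P) ⟩
    (1ℚ +q ℕ→ℚ P) *q y +q (ℚ.- 1ℚ *q y)  ≡⟨ solve 2 (λ p y → (con 1ℚ :+ p) :* y :+ (con (ℚ.- 1ℚ) :* y) := p :* y) refl (ℕ→ℚ P) y ⟩
    ℕ→ℚ P *q y                           ≡⟨ cong (_*q y) (shrink-spec P) ⟨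
    sP *q shrink P *q y                  ≡⟨ ℚ.*-assoc sP (shrink P) y ⟩
    sP *q (shrink P *q y)                ∎)
    where sP = ℕ→ℚ (suc P)

  shrink^-spec : ∀ P j → ℕ→ℚ (suc P ^ j) *q shrink P ^q j ≡ ℕ→ℚ (P ^ j)
  shrink^-spec P zero    = refl
  shrink^-spec P (suc j) = begin-equality
    ℕ→ℚ (suc P * suc P ^ j) *q (t *q t ^q j)                ≡⟨ cong (_*q (t *q t ^q j)) (ℕ→ℚ-* (suc P) (suc P ^ j)) ⟩
    ℕ→ℚ (suc P) *q ℕ→ℚ (suc P ^ j) *q (t *q t ^q j)         ≡⟨ solve 4 (λ a b c d → a :* b :* (c :* d) := (a :* c) :* (b :* d)) refl (ℕ→ℚ (suc P)) (ℕ→ℚ (suc P ^ j)) t (t ^q j) ⟩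
    (ℕ→ℚ (suc P) *q t) *q (ℕ→ℚ (suc P ^ j) *q t ^q j)       ≡⟨ cong₂ _*q_ (shrink-spec P) (shrink^-spec P j) ⟩
    ℕ→ℚ P *q ℕ→ℚ (P ^ j)                                    ≡⟨ ℕ→ℚ-* P (P ^ j) ⟨
    ℕ→ℚ (P * P ^ j) ∎
    where t = shrink P

  amplified : ∀ P L n → n ≤ 2 ^ L → shrink P ^q (suc P * L) *q ℕ→ℚ n ≤q 1ℚ
  amplified P L n n≤ = ℚ.*-cancelˡ-≤-pos (ℕ→ℚ (suc P ^ j)) {{pos (suc P ^ j) (m^n>0 (suc P) j)}} (begin
    ℕ→ℚ (suc P ^ j) *q (shrink P ^q j *q ℕ→ℚ n)   ≡⟨ ℚ.*-assoc (ℕ→ℚ (suc P ^ j)) (shrink P ^q j) (ℕ→ℚ n) ⟨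
    ℕ→ℚ (suc P ^ j) *q shrink P ^q j *q ℕ→ℚ n     ≡⟨ cong (_*q ℕ→ℚ n) (shrink^-spec P j) ⟩
    ℕ→ℚ (P ^ j) *q ℕ→ℚ n                          ≡⟨ ℕ→ℚ-* (P ^ j) n ⟨
    ℕ→ℚ (P ^ j * n)                               ≤⟨ ℕ→ℚ-≤ (decay P L n n≤) ⟩
    ℕ→ℚ (suc P ^ j)                               ≡⟨ ℚ.*-identityʳ _ ⟨
    ℕ→ℚ (suc P ^ j) *q 1ℚ                         ∎)
    where
    j = suc P * L
    pos : ∀ a → 0 < a → Positive (ℕ→ℚ a)
    pos (suc a) _ = ℕ→ℚ-pos a

degree≡cut : (G : Graph n) (u : Fin n) → cutVal (edges G) (u ==_) ≡ degree G u
degree≡cut G u = trans form-rows (trans (sum-δ u (λ x → sum λ v → edges G x v * χ (∁ (u ==_)) v)) (sum-cong-≗ pointwise))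
  where
  pointwise : ∀ v → edges G u v * ⟦ not (u == v) ⟧ ≡ edges G u v
  pointwise v with u Fin.≟ v
  ... | yes refl rewrite irrefl G u = refl
  ... | no _     = *-identityʳ (edges G u v)

minDegree : List (Fin n) → Fin n → ℕ → Routine n (Fin n × ℕ)
minDegree []       u c k = k (u , c)
minDegree (v ∷ vs) u c k = askCut (v ==_) λ c′ → if c′ ≤ᵇ c then minDegree vs v c′ k else minDegree vs u c k

minDegree-computes : ∀ (G : Graph n) vs u c → c ≡ degree G u →
                     ∃ λ w → Computes G (minDegree vs u c) (length vs) (w , degree G w) ×
                             degree G w ≤ degree G u × (∀ {v} → v ∈ vs → degree G w ≤ degree G v)
minDegree-computes G []       u c refl = u , computes-return , ≤-refl , λ ()
minDegree-computes {n} G (v ∷ vs) u c refl = branch (degree G v ≤ᵇ c) refl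
  where
  next : Bool → ℕ → Routine n (Fin n × ℕ)
  next b c′ = if b then minDegree vs v c′ else minDegree vs u c
  reduce : ∀ {w} → Computes G (next (degree G v ≤ᵇ c) (degree G v)) (length vs) (w , degree G w) →
           Computes G (minDegree (v ∷ vs) u c) (suc (length vs)) (w , degree G w)
  reduce {w} h = record { cost = co ; fail = fa }
    where
    asked : Computes G (λ k → askCut (v ==_) λ c′ → next (c′ ≤ᵇ c) c′ k) (suc (length vs)) (w , degree G w)
    asked = computes-bind (askCut (v ==_)) (λ c′ → next (c′ ≤ᵇ c) c′) (askCut-computes (v ==_))
      (subst (λ x → Computes G (next (x ≤ᵇ c) x) (length vs) (w , degree G w)) (sym (degree≡cut G v)) h)
    same : ∀ b c′ k → next b c′ k ≡ (if b then minDegree vs v c′ k else minDegree vs u c k)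
    same true  c′ k = refl
    same false c′ k = refl
    e : ∀ k → next (cut G (tabulate (v ==_)) ≤ᵇ c) (cut G (tabulate (v ==_))) k ≡ _
    e k = same (cut G (tabulate (v ==_)) ≤ᵇ c) (cut G (tabulate (v ==_))) k
    co : ∀ k → queries G (minDegree (v ∷ vs) u c k) ≤ suc (length vs) + queries G (k (w , degree G w))
    co k = subst (λ A → suc (queries G A) ≤ _) (e k) (cost asked k)
    fa : ∀ k → failProb G (minDegree (v ∷ vs) u c k) ≡ failProb G (k (w , degree G w))
    fa k = trans (cong (failProb G) (sym (e k))) (fail asked k)
  branch : ∀ b → (degree G v ≤ᵇ c) ≡ b → ∃ λ w → Computes G (minDegree (v ∷ vs) u c) (suc (length vs)) (w , degree G w) ×
             degree G w ≤ degree G u × (∀ {x} → x ∈ v ∷ vs → degree G w ≤ degree G x)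
  branch true e with minDegree-computes G vs v (degree G v) refl
  ... | w , computes , ≤v , all = w , reduce (subst (λ b → Computes G (next b (degree G v)) _ _) (sym e) computes) ,
    ≤-trans ≤v (≤ᵇ⇒≤ _ c (subst T (sym e) _)) , λ { (here refl) → ≤v ; (there x∈) → all x∈ }
  branch false e with minDegree-computes G vs u c refl
  ... | w , computes , ≤u , all = w , reduce (subst (λ b → Computes G (next b (degree G v)) _ _) (sym e) computes) ,
    ≤u , λ { (here refl) → ≤-trans ≤u (<⇒≤ (≰⇒> λ le → subst T e (≤⇒≤ᵇ le))) ; (there x∈) → all x∈ }

singleton-nontrivial : 2 ≤ n → (v : Fin n) → Nontrivial (v ==_)
singleton-nontrivial (s≤s (s≤s z≤n)) zero    = (zero , refl) , (suc zero , refl)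
singleton-nontrivial (s≤s (s≤s z≤n)) (suc v) = (suc v , ==-refl (suc v)) , (zero , refl)

module Run (d : Fin n) (L δ : ℕ) where

  open Contract d L δ using (unknown; contract; contract-cost; contract-≤)

  -- The fuel `2 * n` suffices after a good contraction: then `N * δ ≤ 2 * n`, and sparsity allows
  -- fewer than `N * δ` known edges.
  trial : Routine n (Subset n)
  trial κ = contract n id λ (N , lab) → Recover.recover d L lab (2 * n) unknown κ

  trialCost : ℕ
  trialCost = n * (1 + L * 3) + 2 * n * (1 + (L * 3 + L * 3))

  -- Only a nontrivial set of strictly smaller value replaces `best`, so a minimum cut once found is
  -- kept. The value travels along, and a round asks a single query beyond its trial.
  amplify : ℕ → Subset n → ℕ → Alg n
  amplify zero    best value = output best
  amplify (suc R) best value = trial λ S → query S λ c →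
    if nontrivialᵇ S ∧ (c <ᵇ value) then amplify R S c else amplify R best value

  module _ (G : Graph n) (n≤2^L : n ≤ 2 ^ L) where

    trial-cost : ∀ {t κ} → (∀ S → queries G (κ S) ≤ t) → queries G (trial κ) ≤ trialCost + t
    trial-cost {t} {κ} h = ≤-trans (contract-cost G n id λ (N , lab) → after N lab)
        (≤-reflexive (sym (+-assoc (n * (1 + L * 3)) (2 * n * (1 + (L * 3 + L * 3))) t)))
      where
      after : ∀ N (lab : Fin n → Fin N) → queries G (Recover.recover d L lab (2 * n) unknown κ) ≤ 2 * n * (1 + (L * 3 + L * 3)) + t
      after N lab with Recover.recover-computes d L lab G n≤2^L (2 * n) unknown
      ... | S , computes , _ = ≤-trans (cost computes κ) (+-monoʳ-≤ (2 * n * (1 + (L * 3 + L * 3))) (h S))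

    amplify-cost : ∀ R best value → queries G (amplify R best value) ≤ R * (trialCost + 1)
    amplify-cost zero    best value = z≤n
    amplify-cost (suc R) best value = ≤-trans (trial-cost {t = 1 + R * (trialCost + 1)} λ S → s≤s (next S (nontrivialᵇ S ∧ (cut G S <ᵇ value))))
        (≤-reflexive (sym (+-assoc trialCost 1 (R * (trialCost + 1)))))
      where
      next : ∀ S b → queries G (if b then amplify R S (cut G S) else amplify R best value) ≤ R * (trialCost + 1)
      next S true  = amplify-cost R S (cut G S)
      next S false = amplify-cost R best value

    trial-≤ : ∀ {y κ} → (∀ S → failProb G (κ S) ≤q y) → failProb G (trial κ) ≤q y
    trial-≤ {y} {κ} h = contract-≤ G n id λ (N , lab) → after N lab
      where
      after : ∀ N (lab : Fin n → Fin N) → failProb G (Recover.recover d L lab (2 * n) unknown κ) ≤q y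
      after N lab with Recover.recover-computes d L lab G n≤2^L (2 * n) unknown
      ... | S , computes , _ = subst (_≤q y) (sym (fail computes κ)) (h S)

    module _ (k : ℕ) (k-large : 54 ≤ suc k) {X : Fin n → Bool} (min : IsMinCut G X) (light : cutVal (edges G) X < δ)
             (min-degree : ∀ u → δ ≤ degree G u) where

      trial-fails : ∀ {y κ} → 0ℚ ≤q y → (∀ S → failProb G (κ S) ≤q y) →
                    (∀ S → IsMinCut G (lookup S) → failProb G (κ S) ≤q 0ℚ) → FailsBy (2 ^ suc k) 1 (failProb G (trial κ)) y
      trial-fails {y} {κ} y≥0 κ≤y κ-good = failsBy-cancel (budget ^ suc k) {{m^n≢0 budget (suc k) {{>-nonZero budget>0}}}}
          (subst₂ (λ D s → FailsBy D s (failProb G (trial κ)) y) scale≡ (sym (*-identityʳ (budget ^ suc k)))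
            (Survival.contract-survives d L δ k n≤2^L k-large G X min light min-degree y≥0
              (λ (N , lab) → after-≤ N lab) after-good n id identity budget fits))
        where
        budget = 2 * (2 ^ n * δ)
        budget>0 : 0 < budget
        budget>0 = *-mono-≤ {1} {2} {1} (s≤s z≤n) (*-mono-≤ (m^n>0 2 n) (≤-<-trans z≤n light))
        scale≡ : (4 * (2 ^ n * δ)) ^ suc k ≡ budget ^ suc k * 2 ^ suc k
        scale≡ = trans (cong (_^ suc k) (e (2 ^ n * δ))) (^-distribˡ-* budget 2 (suc k))
          where
          e : ∀ u → 4 * u ≡ 2 * u * 2
          e = solve-∀
        identity : Respects X id
        identity = record { side = X ; side-lab = λ _ → refl ; surjective = λ ℓ → ℓ , refl }
        fits : budget + potential G X id ≤ 4 * (2 ^ n * δ)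
        fits = ≤-trans (+-monoʳ-≤ budget (≤-trans (potential-initial G X) (*-monoˡ-≤ (2 ^ n) (*-monoʳ-≤ 2 (<⇒≤ light))))) (≤-reflexive (e (2 ^ n) δ))
          where
          e : ∀ u δ → 2 * (u * δ) + 2 * δ * u ≡ 4 * (u * δ)
          e = solve-∀
        after-≤ : ∀ N (lab : Fin n → Fin N) → failProb G (Recover.recover d L lab (2 * n) unknown κ) ≤q y
        after-≤ N lab with Recover.recover-computes d L lab G n≤2^L (2 * n) unknown
        ... | S , computes , _ = subst (_≤q y) (sym (fail computes κ)) (κ≤y S)
        after-good : ∀ {N} (lab : Fin n → Fin N) → Respects X lab → (∀ p → δ < 2 * classSize lab p) →
                     failProb G (Recover.recover d L lab (2 * n) unknown κ) ≤q 0ℚ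
        after-good {N} lab R large with Recover.recover-computes d L lab G n≤2^L (2 * n) unknown
        ... | S , computes , correct = subst (_≤q 0ℚ) (sym (fail computes κ)) (κ-good S (correct {δ} {side R} record
          { surjective   = surjective R
          ; minimum      = nontrivial-cong (λ u → sym (side-lab R u)) (proj₁ min) ,
                           λ Z ntZ → ≤-trans (≤-reflexive (cutVal-cong (edges G) (side-lab R))) (proj₂ min Z ntZ)
          ; light        = ≤-<-trans (≤-reflexive (cutVal-cong (edges G) (side-lab R))) light
          ; known-sym    = λ _ _ → refl
          ; known-≤      = λ _ _ → z≤n
          ; known-sparse = sparse-empty lab δ
          ; enough-fuel  = ≤-trans (≤-reflexive (trans (*-assoc 2 δ N) (cong (2 *_) (*-comm δ N))))
                             (≤-trans (*-monoʳ-≤ 2 (few-classes lab large)) (m≤n+m (2 * (2 * n)) (form unknown (λ _ → 1) (λ _ → 1)))) }))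

    output-≤1 : ∀ S → failProb G (output S) ≤q 1ℚ
    output-≤1 S with isMinCutᵇ G S
    ... | true  = ℕ→ℚ-≤ {0} {1} z≤n
    ... | false = ℚ.≤-refl

    amplify-done : ∀ R best → IsMinCut G (lookup best) → failProb G (amplify R best (cut G best)) ≤q 0ℚ
    amplify-done zero    best min rewrite isMinCutᵇ-intro G best min = ℚ.≤-refl
    amplify-done (suc R) best min = trial-≤ next
      where
      next : ∀ S → failProb G (if nontrivialᵇ S ∧ (cut G S <ᵇ cut G best) then amplify R S (cut G S) else amplify R best (cut G best)) ≤q 0ℚ
      next S with nontrivialᵇ S in nt | cut G S <ᵇ cut G best in lt
      ... | false | _     = amplify-done R best min
      ... | true  | false = amplify-done R best min
      ... | true  | true  = contradiction (<ᵇ⇒< _ _ (subst T (sym lt) _))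
        (≤⇒≯ (subst₂ _≤_ (sym (cut≡cutVal G best)) (sym (cut≡cutVal G S)) (proj₂ min (lookup S) (nontrivialᵇ-elim S nt))))

    module _ (P k : ℕ) (k-large : 54 ≤ suc k) (P≡ : 2 ^ suc k ≡ suc P) {X : Fin n → Bool} (min : IsMinCut G X)
             (min-degree : ∀ u → δ ≤ degree G u) where

      -- Either `best` is minimum already, or its value, which is at most `δ`, exceeds that of `X`.
      -- The second case yields the strict inequality that the analysis of a trial assumes, and each
      -- such trial contributes one factor `shrink P`.
      amplify-fails : ∀ R best → Nontrivial (lookup best) → cut G best ≤ δ →
                      failProb G (amplify R best (cut G best)) ≤q shrink P ^q R
      amplify-fails zero    best nt ≤δ = output-≤1 best
      amplify-fails (suc R) best nt ≤δ with cut G best ≤? cutVal (edges G) X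
      ... | yes le = ℚ.≤-trans (amplify-done (suc R) best
        (nt , λ Z ntZ → ≤-trans (≤-trans (≤-reflexive (sym (cut≡cutVal G best))) le) (proj₂ min Z ntZ))) (shrink^-≥0 P (suc R))
      ... | no gt = failsBy⇒shrink P (subst (λ D → FailsBy D 1 (failProb G (amplify (suc R) best (cut G best))) (shrink P ^q R)) P≡
          (trial-fails k k-large min (<-≤-trans (≰⇒> gt) ≤δ) min-degree (shrink^-≥0 P R) next good))
        where
        next : ∀ S → failProb G (if nontrivialᵇ S ∧ (cut G S <ᵇ cut G best) then amplify R S (cut G S) else amplify R best (cut G best)) ≤q shrink P ^q R
        next S with nontrivialᵇ S in ntS | cut G S <ᵇ cut G best in lt
        ... | false | _     = amplify-fails R best nt ≤δ
        ... | true  | false = amplify-fails R best nt ≤δ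
        ... | true  | true  = amplify-fails R S (nontrivialᵇ-elim S ntS) (≤-trans (<⇒≤ (<ᵇ⇒< _ _ (subst T (sym lt) _))) ≤δ)
        good : ∀ S → IsMinCut G (lookup S) → failProb G (if nontrivialᵇ S ∧ (cut G S <ᵇ cut G best) then amplify R S (cut G S) else amplify R best (cut G best)) ≤q 0ℚ
        good S minS with nontrivialᵇ S in ntS | cut G S <ᵇ cut G best in lt
        ... | true  | true  = amplify-done R S minS
        ... | true  | false = contradiction (<⇒<ᵇ (≤-<-trans (≤-trans (≤-reflexive (cut≡cutVal G S)) (proj₂ minS X (proj₁ min))) (≰⇒> gt))) (subst T lt)
        ... | false | _     = contradiction (trans (sym (nontrivialᵇ-intro S (proj₁ minS))) ntS) λ ()

-- The complete algorithm and its constants.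

abstract
  -- Any value with `54 ≤ suc exponent` satisfies the budget step; 64 is a round choice.
  exponent : ℕ
  exponent = 63

  exponent-large : 54 ≤ suc exponent
  exponent-large = m≤m+n 54 10

  -- A trial starts with half of the scale as its budget, so it succeeds with probability at least
  -- (1 / 2) ^ suc exponent = 1 / (1 + rarity).
  rarity : ℕ
  rarity = 2 ^ suc exponent ∸ 1

  rarity-spec : 2 ^ suc exponent ≡ suc rarity
  rarity-spec = sym (m+[n∸m]≡n (m^n>0 2 (suc exponent)))

minCutAlg : ∀ n → Alg n
minCutAlg zero    = output []
minCutAlg (suc n) = askCut (zero ==_) λ c → minDegree (List.allFin (suc n)) zero c λ (w , δ) →
  Run.amplify zero ⌈log₂ suc n ⌉ δ (suc rarity * ⌈log₂ suc n ⌉) (tabulate (w ==_)) δ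

minCutAlg-correct : ∀ n → 2 ≤ n → (G : Graph n) →
                    (queries G (minCutAlg n) ≤ (2 + suc rarity * 19) * n * ⌈log₂ n ⌉ ^ 2) ×
                    ((failProb G (minCutAlg n) ^q 1) *q (ℕ→ℚ n ^q 1) ≤q 1ℚ)
minCutAlg-correct n@(suc m) 2≤n G with minDegree-computes G (List.allFin n) zero (degree G zero) refl
... | w , computes , _ , smallest = query-bound , fail-bound
  where
  L = ⌈log₂ n ⌉
  δ = degree G w
  R = suc rarity * L
  best : Subset n
  best = tabulate (w ==_)
  n≤2^L : n ≤ 2 ^ L
  n≤2^L = n≤2^⌈log₂n⌉ n
  1≤L : 1 ≤ L
  1≤L = ⌈log₂⌉-mono-≤ {2} {n} 2≤n
  open Run {n} zero L δ using (amplify; amplify-cost; amplify-fails; trialCost)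
  started : Computes G (λ k → askCut (zero ==_) λ c → minDegree (List.allFin n) zero c k) (1 + n) (w , δ)
  started = computes-bind (askCut (zero ==_)) (λ c → minDegree (List.allFin n) zero c) (askCut-computes (zero ==_))
    (subst₂ (λ c t → Computes G (minDegree (List.allFin n) zero c) t (w , δ)) (sym (degree≡cut G zero)) (length-tabulate {n = n} id) computes)
  κ : Fin n × ℕ → Alg n
  κ (w , δ) = Run.amplify zero L δ R (tabulate (w ==_)) δ
  δ≡ : δ ≡ cut G best
  δ≡ = sym (trans (cut≡cutVal G best) (trans (cutVal-cong (edges G) (lookup∘tabulate (w ==_))) (degree≡cut G w)))

  query-bound : queries G (minCutAlg n) ≤ (2 + suc rarity * 19) * n * L ^ 2
  query-bound = begin
    queries G (minCutAlg n)                           ≤⟨ cost started κ ⟩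
    (1 + n) + queries G (amplify R best δ)            ≤⟨ +-monoʳ-≤ (1 + n) (amplify-cost G n≤2^L R best δ) ⟩
    (1 + n) + R * (trialCost + 1)                     ≤⟨ +-mono-≤ setup (*-monoʳ-≤ R trial≤) ⟩
    2 * n * (L * L) + R * (19 * (n * L))              ≡⟨ e (suc rarity) n L ⟩
    (2 + suc rarity * 19) * n * (L * (L * 1))         ∎
    where
    open ≤-Reasoning
    e : ∀ q n L → 2 * n * (L * L) + q * L * (19 * (n * L)) ≡ (2 + q * 19) * n * (L * (L * 1))
    e = solve-∀
    n≤nL : n ≤ n * L
    n≤nL = ≤-trans (≤-reflexive (sym (*-identityʳ n))) (*-monoʳ-≤ n 1≤L)
    setup : 1 + n ≤ 2 * n * (L * L)
    setup = begin
      1 + n              ≤⟨ +-monoˡ-≤ n (≤-trans (s≤s z≤n) 2≤n) ⟩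
      n + n              ≡⟨ cong (n +_) (+-identityʳ n) ⟨
      2 * n              ≡⟨ *-identityʳ (2 * n) ⟨
      2 * n * 1          ≤⟨ *-monoʳ-≤ (2 * n) (*-mono-≤ 1≤L 1≤L) ⟩
      2 * n * (L * L)    ∎
    -- Contraction and recovery cost `3 * n + 15 * (n * L)`, and evaluating the answer costs one
    -- more query. As `1 ≤ L`, the terms `3 * n` and `1` fit into `4 * (n * L)`.
    trial≤ : trialCost + 1 ≤ 19 * (n * L)
    trial≤ = begin
      n * (1 + L * 3) + 2 * n * (1 + (L * 3 + L * 3)) + 1   ≡⟨ e₁ n L ⟩
      3 * n + 1 + 15 * (n * L)                              ≤⟨ +-monoˡ-≤ (15 * (n * L)) (+-mono-≤ (*-monoʳ-≤ 3 n≤nL) (≤-trans (≤-trans (s≤s z≤n) 2≤n) n≤nL)) ⟩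
      3 * (n * L) + n * L + 15 * (n * L)                    ≡⟨ e₂ (n * L) ⟩
      19 * (n * L)                                          ∎
      where
      e₁ : ∀ n L → n * (1 + L * 3) + 2 * n * (1 + (L * 3 + L * 3)) + 1 ≡ 3 * n + 1 + 15 * (n * L)
      e₁ = solve-∀
      e₂ : ∀ x → 3 * x + x + 15 * x ≡ 19 * x
      e₂ = solve-∀
  fail-bound : (failProb G (minCutAlg n) ^q 1) *q (ℕ→ℚ n ^q 1) ≤q 1ℚ
  fail-bound = subst₂ (λ F x → F *q x ≤q 1ℚ) (sym (trans (ℚ.*-identityʳ _) (fail started κ))) (sym (ℚ.*-identityʳ (ℕ→ℚ n))) (ℚ.≤-trans
    (ℚ.*-monoʳ-≤-nonNeg (ℕ→ℚ n) {{ℕ→ℚ-nonNeg n}} run)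
    (amplified rarity L n n≤2^L))
    where
    run : failProb G (amplify R best δ) ≤q shrink rarity ^q R
    run = let X , min = minCut-exists G (singleton-nontrivial 2≤n zero) in
      subst (λ v → failProb G (amplify R best v) ≤q shrink rarity ^q R) (sym δ≡)
        (amplify-fails G n≤2^L rarity exponent exponent-large rarity-spec min (λ u → smallest (∈-allFin u)) R best
          (nontrivial-cong (λ u → sym (lookup∘tabulate (w ==_) u)) (singleton-nontrivial 2≤n w)) (≤-reflexive (sym δ≡)))

theorem1p1 : Σ ((n : ℕ) → Alg n) λ A →
    Σ ℕ λ C → Σ ℕ λ k → Σ ℕ λ a → Σ ℕ λ b → Σ ℕ λ n₀ →
    (0 < a) × (0 < b) ×
    ((n : ℕ) → n₀ ≤ n → (G : Graph n) →
    (queries G (A n) ≤ C * n * (⌈log₂ n ⌉ ^ k))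
    × ((failProb G (A n) ^q b) *q (ℕ→ℚ n ^q a) ≤q 1ℚ))
theorem1p1 = minCutAlg , 2 + suc rarity * 19 , 2 , 1 , 1 , 2 , s≤s z≤n , s≤s z≤n , minCutAlg-correct
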